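{- Let $P\subseteq\mathbb{R}$ be a set of $n$ numbers and let $f:P\to(M,\rho)$ be a mapping into an arbitrary metric space given as a matrix (of distances). Computing the Lipschitz constant of $f$ on $P$ can be done in $O(n\log n)$ time.
   Context: The metric on $P$ is $|x-y|$. A function $f:P\to(M,\rho)$ is $K$-Lipschitz if $\rho(f(x),f(y))\le K\,|x-y|$ for all $x,y\in P$. The Lipschitz constant of $f$ is the smallest such $K$, i.e. $\max_{x\neq y\in P}\rho(f(x),f(y))/|x-y|$. Arithmetic operations and comparisons on the input numbers, and access to an entry $\rho(f(x),f(y))$ of the matrix, take unit time (numerical precision issues are ignored). -}

module Defs where

open import Algebra.Core using (Op₁; Op₂)
open import Algebra.Structures using (IsCommutativeRing)
open import Data.Bool.Base using (Bool; true; false; not; _∧_; if_then_else_)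
open import Data.Fin.Base using (Fin; zero; suc)
open import Data.Nat.Base using (ℕ; zero; suc)
import Data.Nat.Base as ℕ
import Data.Nat.Properties as ℕ
open import Data.Product.Base using (∃; ∃-syntax; _×_)
open import Function.Base using (_∘_)
open import Function.Definitions using (Injective)
open import Function.Metric.Structures using (IsGeneralMetric)
open import Level using (Level; _⊔_) renaming (suc to lsuc)
open import Relation.Binary.Core using (Rel)
open import Relation.Binary.PropositionalEquality.Core using (_≡_)
open import Relation.Binary.Structures using (IsDecTotalOrder)
open import Relation.Nullary.Decidable.Core using (does)
open import Relation.Nullary.Negation.Core using (¬_)
open import Relation.Unary using (Pred)

------------------------------------------------------------------------
-- The real numbers

-- The reals are specified, up to isomorphism, as a complete ordered
-- field.  Decidability of the order is the classical trichotomy that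
-- the unit-time comparison of a real RAM relies on.  As usual for a
-- total inverse, nothing is assumed about the value of 0# ⁻¹.

record RealNumbers (c ℓ₁ ℓ₂ : Level) : Set (lsuc (c ⊔ ℓ₁ ⊔ ℓ₂)) where
  infix  9 _⁻¹
  infix  8 -_
  infixl 7 _*_
  infixl 6 _+_
  infix  4 _≈_ _≤_
  field
    Carrier           : Set c
    _≈_               : Rel Carrier ℓ₁
    _≤_               : Rel Carrier ℓ₂
    _+_ _*_           : Op₂ Carrier
    -_ _⁻¹            : Op₁ Carrier
    0# 1#             : Carrier
    isCommutativeRing : IsCommutativeRing _≈_ _+_ _*_ -_ 0# 1#
    0≉1               : ¬ (0# ≈ 1#)
    ⁻¹-inverseʳ       : ∀ x → ¬ (x ≈ 0#) → x * x ⁻¹ ≈ 1#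
    isDecTotalOrder   : IsDecTotalOrder _≈_ _≤_
    +-monoˡ-≤         : ∀ z {x y} → x ≤ y → x + z ≤ y + z
    *-nonNegative     : ∀ {x y} → 0# ≤ x → 0# ≤ y → 0# ≤ x * y

  IsUpperBound : ∀ {p} → Pred Carrier p → Carrier → Set (c ⊔ ℓ₂ ⊔ p)
  IsUpperBound S b = ∀ x → S x → x ≤ b

  field
    complete : (S : Pred Carrier (c ⊔ ℓ₁ ⊔ ℓ₂)) → ∃ S → ∃ (IsUpperBound S) →
               ∃[ s ] IsUpperBound S s × (∀ b → IsUpperBound S b → s ≤ b)

  open IsCommutativeRing isCommutativeRing public using (_-_)
  open IsDecTotalOrder isDecTotalOrder public using (_≤?_)

  infixl 7 _÷_
  _÷_ : Op₂ Carrier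
  x ÷ y = x * y ⁻¹

  ∣_∣ : Op₁ Carrier
  ∣ x ∣ = if does (0# ≤? x) then x else - x

------------------------------------------------------------------------
-- Metric spaces, finite sets of reals and Lipschitz constants

record MetricSpace {c ℓ₁ ℓ₂} (ℝ : RealNumbers c ℓ₁ ℓ₂) (m ℓ : Level)
                   : Set (c ⊔ ℓ₁ ⊔ ℓ₂ ⊔ lsuc (m ⊔ ℓ)) where
  private module ℝ = RealNumbers ℝ
  infix 4 _≈_
  field
    Carrier  : Set m
    _≈_      : Rel Carrier ℓ
    ρ        : Carrier → Carrier → ℝ.Carrier
    isMetric : IsGeneralMetric _≈_ ℝ._≈_ ℝ._≤_ ℝ.0# ℝ._+_ ρ

-- A set P of n reals is listed without repetition, in arbitrary (not
-- necessarily sorted) order.  A map on P is then a map on the indices.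

record PointSet {c ℓ₁ ℓ₂} (ℝ : RealNumbers c ℓ₁ ℓ₂) (n : ℕ)
                : Set (c ⊔ ℓ₁) where
  private module ℝ = RealNumbers ℝ
  field
    point    : Fin n → ℝ.Carrier
    distinct : Injective _≡_ ℝ._≈_ point

module _ {c ℓ₁ ℓ₂ m ℓ} (ℝ : RealNumbers c ℓ₁ ℓ₂) {n : ℕ}
         (P : PointSet ℝ n) (M : MetricSpace ℝ m ℓ)
         (f : Fin n → MetricSpace.Carrier M) where
  open RealNumbers ℝ
  open PointSet P
  open MetricSpace M using (ρ)

  IsLipschitz : Carrier → Set ℓ₂
  IsLipschitz K = ∀ i j → ρ (f i) (f j) ≤ K * ∣ point i - point j ∣

  -- Constants are taken to be nonnegative.  This is automatic when
  -- n ≥ 2; when n ≤ 1 it makes the Lipschitz constant 0, where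
  -- otherwise no smallest K would exist.

  IsLipschitzConstant : Carrier → Set (c ⊔ ℓ₂)
  IsLipschitzConstant K =
    0# ≤ K × IsLipschitz K × (∀ K′ → 0# ≤ K′ → IsLipschitz K′ → K ≤ K′)

------------------------------------------------------------------------
-- Asymptotic upper bounds

infix 4 _∈O_
_∈O_ : (ℕ → ℕ) → (ℕ → ℕ) → Set
T ∈O g = ∃[ C ] ∃[ n₀ ] (∀ n → n₀ ℕ.≤ n → T n ℕ.≤ C ℕ.* g n)

------------------------------------------------------------------------
-- Real RAM programs

-- The machine has integer and real memory, both organised as arrays.
-- The name of an array is fixed in the program text, so a program uses
-- finitely many of them, while the index into an array is computed at
-- run time.  A variable is an array used at index 0.  Integers admit
-- only addition and truncated subtraction, and there is no conversion
-- (such as rounding) between integers and reals.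

infixl 6 _⊕_ _⊖_ _+ᴿ_ _-ᴿ_
infixl 7 _*ᴿ_ _÷ᴿ_
infix  8 _[_]ᴺ _[_]ᴿ

data ℕExp : Set where
  lit     : ℕ → ℕExp
  size    : ℕExp                 -- the number n of input points
  _[_]ᴺ   : ℕ → ℕExp → ℕExp
  _⊕_ _⊖_ : ℕExp → ℕExp → ℕExp

data ℝExp : Set where
  0ᴿ 1ᴿ                    : ℝExp
  _[_]ᴿ                    : ℕ → ℕExp → ℝExp
  input                    : ℕExp → ℝExp          -- a point of P
  dist                     : ℕExp → ℕExp → ℝExp   -- an entry of the matrix
  _+ᴿ_ _-ᴿ_ _*ᴿ_ _÷ᴿ_ : ℝExp → ℝExp → ℝExp

infix 4 _≤ᴺ_ _≤ᴿ_
infix 3 _[_]ᴺ≔_ _[_]ᴿ≔_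
infixr 2 _⨾_

data Test : Set where
  _≤ᴺ_ : ℕExp → ℕExp → Test
  _≤ᴿ_ : ℝExp → ℝExp → Test
  notᵀ : Test → Test
  _∧ᵀ_ : Test → Test → Test

data Program : Set where
  skip           : Program
  _[_]ᴺ≔_        : ℕ → ℕExp → ℕExp → Program
  _[_]ᴿ≔_        : ℕ → ℕExp → ℝExp → Program
  _⨾_            : Program → Program → Program
  if_then_else_end : Test → Program → Program → Program
  while_loop_    : Test → Program → Program

-- Every memory access, input or matrix access, constant, operation,
-- comparison and assignment takes unit time.

costᴺ : ℕExp → ℕ
costᴺ (lit k)    = 1
costᴺ size       = 1
costᴺ (a [ e ]ᴺ) = 1 ℕ.+ costᴺ e
costᴺ (d ⊕ e)    = 1 ℕ.+ costᴺ d ℕ.+ costᴺ e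
costᴺ (d ⊖ e)    = 1 ℕ.+ costᴺ d ℕ.+ costᴺ e

costᴿ : ℝExp → ℕ
costᴿ 0ᴿ         = 1
costᴿ 1ᴿ         = 1
costᴿ (a [ e ]ᴿ) = 1 ℕ.+ costᴺ e
costᴿ (input e)  = 1 ℕ.+ costᴺ e
costᴿ (dist d e) = 1 ℕ.+ costᴺ d ℕ.+ costᴺ e
costᴿ (r +ᴿ s)   = 1 ℕ.+ costᴿ r ℕ.+ costᴿ s
costᴿ (r -ᴿ s)   = 1 ℕ.+ costᴿ r ℕ.+ costᴿ s
costᴿ (r *ᴿ s)   = 1 ℕ.+ costᴿ r ℕ.+ costᴿ s
costᴿ (r ÷ᴿ s)   = 1 ℕ.+ costᴿ r ℕ.+ costᴿ s

costᵀ : Test → ℕ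
costᵀ (d ≤ᴺ e)  = 1 ℕ.+ costᴺ d ℕ.+ costᴺ e
costᵀ (r ≤ᴿ s)  = 1 ℕ.+ costᴿ r ℕ.+ costᴿ s
costᵀ (notᵀ b)  = 1 ℕ.+ costᵀ b
costᵀ (b ∧ᵀ b′) = 1 ℕ.+ costᵀ b ℕ.+ costᵀ b′

------------------------------------------------------------------------
-- Execution

Memory : ∀ {a} → Set a → Set a
Memory A = ℕ → ℕ → A

write : ∀ {a} {A : Set a} → ℕ → ℕ → A → Memory A → Memory A
write a i v μ b j =
  if does (b ℕ.≟ a) ∧ does (j ℕ.≟ i) then v else μ b j

-- Reading outside the bounds of the input returns the default value.

nth : ∀ {a} {A : Set a} {n} → A → (Fin n → A) → ℕ → A
nth {n = zero}  d v k       = d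
nth {n = suc n} d v zero    = v zero
nth {n = suc n} d v (suc k) = nth d (v ∘ suc) k

module RealRAM {c ℓ₁ ℓ₂} (ℝ : RealNumbers c ℓ₁ ℓ₂) where
  open RealNumbers ℝ

  record Input (n : ℕ) : Set c where
    field
      points : Fin n → Carrier
      matrix : Fin n → Fin n → Carrier

  record State : Set c where
    constructor state
    field
      ints  : Memory ℕ
      reals : Memory Carrier

  open State public

  initial : State
  initial = state (λ _ _ → 0) (λ _ _ → 0#)

  output : State → Carrier
  output σ = reals σ 0 0

  module _ {n : ℕ} (I : Input n) where
    open Input I

    evalᴺ : ℕExp → State → ℕ
    evalᴺ (lit k)    σ = k
    evalᴺ size       σ = n
    evalᴺ (a [ e ]ᴺ) σ = ints σ a (evalᴺ e σ)
    evalᴺ (d ⊕ e)    σ = evalᴺ d σ ℕ.+ evalᴺ e σ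
    evalᴺ (d ⊖ e)    σ = evalᴺ d σ ℕ.∸ evalᴺ e σ

    evalᴿ : ℝExp → State → Carrier
    evalᴿ 0ᴿ         σ = 0#
    evalᴿ 1ᴿ         σ = 1#
    evalᴿ (a [ e ]ᴿ) σ = reals σ a (evalᴺ e σ)
    evalᴿ (input e)  σ = nth 0# points (evalᴺ e σ)
    evalᴿ (dist d e) σ =
      nth 0# (λ i → nth 0# (matrix i) (evalᴺ e σ)) (evalᴺ d σ)
    evalᴿ (r +ᴿ s)   σ = evalᴿ r σ + evalᴿ s σ
    evalᴿ (r -ᴿ s)   σ = evalᴿ r σ - evalᴿ s σ
    evalᴿ (r *ᴿ s)   σ = evalᴿ r σ * evalᴿ s σ
    evalᴿ (r ÷ᴿ s)   σ = evalᴿ r σ ÷ evalᴿ s σ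

    evalᵀ : Test → State → Bool
    evalᵀ (d ≤ᴺ e)  σ = does (evalᴺ d σ ℕ.≤? evalᴺ e σ)
    evalᵀ (r ≤ᴿ s)  σ = does (evalᴿ r σ ≤? evalᴿ s σ)
    evalᵀ (notᵀ b)  σ = not (evalᵀ b σ)
    evalᵀ (b ∧ᵀ b′) σ = evalᵀ b σ ∧ evalᵀ b′ σ

  -- I ⊢⟨ p , σ ⟩⇓[ t ] τ: on input I, started in σ, the program p halts
  -- in τ after exactly t time units.

  infix 1 _⊢⟨_,_⟩⇓[_]_
  data _⊢⟨_,_⟩⇓[_]_ {n} (I : Input n) : Program → State → ℕ → State → Set c where
    skip : ∀ {σ} → I ⊢⟨ skip , σ ⟩⇓[ 1 ] σ
    assignᴺ : ∀ {a d e σ} →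
      I ⊢⟨ a [ d ]ᴺ≔ e , σ ⟩⇓[ 1 ℕ.+ costᴺ d ℕ.+ costᴺ e ]
      record σ { ints = write a (evalᴺ I d σ) (evalᴺ I e σ) (ints σ) }
    assignᴿ : ∀ {a d r σ} →
      I ⊢⟨ a [ d ]ᴿ≔ r , σ ⟩⇓[ 1 ℕ.+ costᴺ d ℕ.+ costᴿ r ]
      record σ { reals = write a (evalᴺ I d σ) (evalᴿ I r σ) (reals σ) }
    seq : ∀ {p q s t σ τ υ} →
      I ⊢⟨ p , σ ⟩⇓[ s ] τ → I ⊢⟨ q , τ ⟩⇓[ t ] υ →
      I ⊢⟨ p ⨾ q , σ ⟩⇓[ s ℕ.+ t ] υ
    if-true : ∀ {b p q t σ τ} → evalᵀ I b σ ≡ true →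
      I ⊢⟨ p , σ ⟩⇓[ t ] τ →
      I ⊢⟨ if b then p else q end , σ ⟩⇓[ costᵀ b ℕ.+ t ] τ
    if-false : ∀ {b p q t σ τ} → evalᵀ I b σ ≡ false →
      I ⊢⟨ q , σ ⟩⇓[ t ] τ →
      I ⊢⟨ if b then p else q end , σ ⟩⇓[ costᵀ b ℕ.+ t ] τ
    while-true : ∀ {b p s t σ τ υ} → evalᵀ I b σ ≡ true →
      I ⊢⟨ p , σ ⟩⇓[ s ] τ → I ⊢⟨ while b loop p , τ ⟩⇓[ t ] υ →
      I ⊢⟨ while b loop p , σ ⟩⇓[ costᵀ b ℕ.+ s ℕ.+ t ] υ
    while-false : ∀ {b p σ} → evalᵀ I b σ ≡ false →
      I ⊢⟨ while b loop p , σ ⟩⇓[ costᵀ b ] σ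

-- The machine sees the values of f only through their distances.

inputOf : ∀ {c ℓ₁ ℓ₂ m ℓ} (ℝ : RealNumbers c ℓ₁ ℓ₂) {n} → PointSet ℝ n →
          (M : MetricSpace ℝ m ℓ) → (Fin n → MetricSpace.Carrier M) →
          RealRAM.Input ℝ n
inputOf ℝ P M f = record
  { points = PointSet.point P
  ; matrix = λ i j → MetricSpace.ρ M (f i) (f j)
  }

-- By the triangle inequality the Lipschitz constant is attained on
-- consecutive points, so after sorting P it is the maximum of n - 1
-- ratios.  Sorting is bottom-up merge sort: each round merges the sorted
-- runs in pairs in linear time and halves their number, so ⌈log₂ n⌉
-- rounds suffice.  Merged runs are appended to a tape whose written cells
-- never change, which makes earlier runs survive later writes, and a round
-- has exactly the effect of mergePairs on the list of runs.

module Submission where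

open import Algebra.Bundles using (CommutativeRing)
import Algebra.Properties.Ring as RingProperties
open import Data.Bool.Base using (true; false)
open import Data.Bool.Properties using (∧-zeroʳ; not-involutive)
open import Data.Fin.Base using (Fin; zero; suc; toℕ)
import Data.Fin.Properties as Fin
open import Data.List.Base using (List; []; _∷_; [_]; length; map; merge; concat; allFin; tabulate)
open import Data.List.Membership.Propositional using (_∈_)
open import Data.List.Membership.Propositional.Properties using (∈-allFin)
open import Data.List.Properties using (length-++; length-map; length-tabulate; concat-map-[_])
open import Data.List.Relation.Binary.Permutation.Propositional using (_↭_; ↭-refl; ↭-sym; ↭-trans)
open import Data.List.Relation.Binary.Permutation.Propositional.Properties
  using (++-identityʳ; ↭-length; ∈-resp-↭)
open import Data.List.Relation.Unary.All as All using (All; []; _∷_)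
import Data.List.Relation.Unary.All.Properties as All
open import Data.List.Relation.Unary.AllPairs using (AllPairs; []; _∷_)
open import Data.List.Relation.Unary.Any using (here; there)
open import Data.List.Relation.Unary.Linked as Linked using (Linked; []; [-]; _∷_)
open import Data.List.Relation.Unary.Linked.Properties using (Linked⇒AllPairs)
import Data.List.Sort.MergeSort.Base as MergeSort
import Data.List.Sort.MergeSort.Properties as MergeSortProperties
import Data.Nat.Base as ℕ
open import Data.Nat.Base using (ℕ; zero; suc)
open import Data.Nat.Induction using (<-rec)
open import Data.Nat.Logarithm using (⌈log₂_⌉; ⌊log₂_⌋; ⌈log₂⌉-mono-≤; ⌊log₂⌋-mono-≤;
  ⌈log₂⌈n/2⌉⌉≡⌈log₂n⌉∸1; ⌊log₂⌊n/2⌋⌋≡⌊log₂n⌋∸1)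
import Data.Nat.Properties as ℕ
open import Data.Nat.Tactic.RingSolver using (solve-∀)
open import Data.Product.Base using (∃-syntax; _×_; _,_; proj₁; proj₂)
open import Data.Sum.Base using (_⊎_; inj₁; inj₂)
open import Function.Base using (_∘_)
open import Function.Metric.Structures using (IsGeneralMetric)
open import Level using (_⊔_)
open import Relation.Binary.Bundles using (DecTotalOrder)
import Relation.Binary.Construct.On as On
open import Relation.Binary.Core using (Rel)
open import Relation.Binary.Definitions using (Transitive; Decidable)
import Relation.Binary.Properties.DecTotalOrder as DecTotalOrderProperties
open import Relation.Binary.PropositionalEquality as ≡ using (_≡_)
import Relation.Binary.Reasoning.PartialOrder as PosetReasoning
open import Relation.Nullary.Decidable using (Dec; does; yes; no; dec-true; dec-false)
open import Relation.Nullary.Negation using (¬_; contradiction)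

open import Algebra.Properties.CommutativeSemigroup ℕ.+-commutativeSemigroup using (x∙yz≈y∙xz)

open import Defs

-- Bounds on ratios do not compose along a chain of points, but their division-free form, distance
-- at most `K` times gap, does: the gaps of a sorted chain add up to the outer gap. Read as a
-- transitive relation, it spreads from neighbours to all pairs. The value of `0# ⁻¹` is unknown,
-- but a ratio with equal indices has numerator 0, so repeated entries never have to be excluded.
-- Correctness and running time are proved together. Each sorting loop follows the recursion of a
-- list function, so order and permutation come from the list level. A constant is charged per
-- iteration, and the final failing test of an inner loop is charged to the body containing it. A
-- round is linear because every iteration of the innermost loop appends one index and merging
-- preserves the number of indices. The number of rounds is a rounded-up logarithm while the claimed
-- bound is rounded down; the two differ by at most 1, which is absorbed once there are two points.

AllPairs-∈ : ∀ {a r} {A : Set a} {R : Rel A r} {xs x y} →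
  AllPairs R xs → x ∈ xs → y ∈ xs → x ≡ y ⊎ R x y ⊎ R y x
AllPairs-∈ (_ ∷ _)   (here x≡)  (here y≡)  = inj₁ (≡.trans x≡ (≡.sym y≡))
AllPairs-∈ (Rx ∷ _)  (here ≡.refl) (there y∈) = inj₂ (inj₁ (All.lookup Rx y∈))
AllPairs-∈ (Ry ∷ _)  (there x∈) (here ≡.refl) = inj₂ (inj₂ (All.lookup Ry x∈))
AllPairs-∈ (_ ∷ Rxs) (there x∈) (there y∈) = AllPairs-∈ Rxs x∈ y∈

-- Not definitional for a variable list, since `merge` splits on its first argument first. Needed
-- when the right run is exhausted and when the last run has no partner.
merge-[]ʳ : ∀ {a r} {A : Set a} {R : Rel A r} (R? : Decidable R) xs → merge R? xs [] ≡ xs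
merge-[]ʳ R? []       = ≡.refl
merge-[]ʳ R? (x ∷ xs) = ≡.refl

-- Arithmetic in an ordered field.

module OrderedField {c ℓ₁ ℓ₂} (ℝ : RealNumbers c ℓ₁ ℓ₂) where
  open RealNumbers ℝ

  commutativeRing : CommutativeRing c ℓ₁
  commutativeRing = record { isCommutativeRing = isCommutativeRing }

  decTotalOrder : DecTotalOrder c ℓ₁ ℓ₂
  decTotalOrder = record { isDecTotalOrder = isDecTotalOrder }

  open CommutativeRing commutativeRing public
    using (ring; +-congˡ; +-congʳ; +-identityˡ; +-identityʳ; +-assoc; +-comm; -‿inverseˡ; -‿inverseʳ;
           -‿cong; *-congˡ; *-congʳ; *-identityˡ; *-identityʳ; *-assoc; *-comm; zeroˡ; zeroʳ; distribˡ)
  open RingProperties ring public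
    using (-‿distribˡ-*; -‿distribʳ-*; [y-z]x≈yx-zx; -0#≈0#; -‿involutive; ⁻¹-anti-homo‿-; x∙y⁻¹≈ε⇒x≈y)
  open DecTotalOrder decTotalOrder public
    using (poset; antisym; total; ≤-respˡ-≈; ≤-respʳ-≈)
    renaming (reflexive to ≤-reflexive; refl to ≤-refl; trans to ≤-trans)
  open DecTotalOrderProperties decTotalOrder public using (≰⇒≥)
  module ≈ = DecTotalOrder.Eq decTotalOrder
  open PosetReasoning poset

  0≤y-x : ∀ {x y} → x ≤ y → 0# ≤ y - x
  0≤y-x {x} {y} x≤y = begin
    0#       ≈⟨ -‿inverseʳ x ⟨
    x - x    ≤⟨ +-monoˡ-≤ (- x) x≤y ⟩
    y - x    ∎

  0≤y-x⇒x≤y : ∀ {x y} → 0# ≤ y - x → x ≤ y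
  0≤y-x⇒x≤y {x} {y} 0≤y-x = begin
    x              ≈⟨ +-identityˡ x ⟨
    0# + x         ≤⟨ +-monoˡ-≤ x 0≤y-x ⟩
    y - x + x      ≈⟨ +-assoc y (- x) x ⟩
    y + (- x + x)  ≈⟨ +-congˡ (-‿inverseˡ x) ⟩
    y + 0#         ≈⟨ +-identityʳ y ⟩
    y              ∎

  +-mono-≤ : ∀ {w x y z} → w ≤ x → y ≤ z → w + y ≤ x + z
  +-mono-≤ {w} {x} {y} {z} w≤x y≤z = begin
    w + y  ≤⟨ +-monoˡ-≤ y w≤x ⟩
    x + y  ≈⟨ +-comm x y ⟩
    y + x  ≤⟨ +-monoˡ-≤ x y≤z ⟩
    z + x  ≈⟨ +-comm z x ⟩
    x + z  ∎

  *-monoˡ-≤ : ∀ {x y z} → 0# ≤ z → x ≤ y → x * z ≤ y * z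
  *-monoˡ-≤ {x} {y} {z} 0≤z x≤y =
    0≤y-x⇒x≤y (≤-respʳ-≈ ([y-z]x≈yx-zx z y x) (*-nonNegative (0≤y-x x≤y) 0≤z))

  neg-nonNegative : ∀ {x} → x ≤ 0# → 0# ≤ - x
  neg-nonNegative {x} x≤0 = ≤-respʳ-≈ (+-identityˡ (- x)) (0≤y-x x≤0)

  -x*-y≈x*y : ∀ x y → - x * - y ≈ x * y
  -x*-y≈x*y x y = ≈.trans (≈.sym (-‿distribˡ-* x (- y)))
    (≈.trans (-‿cong (≈.sym (-‿distribʳ-* x y))) (-‿involutive (x * y)))

  -- If `1# ≤ 0#`, then `1#` is the square of the nonnegative `- 1#`.
  0≤1 : 0# ≤ 1#
  0≤1 with total 0# 1#
  ... | inj₁ 0≤1 = 0≤1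
  ... | inj₂ 1≤0 = ≤-respʳ-≈ (≈.trans (-x*-y≈x*y 1# 1#) (*-identityˡ 1#))
                     (*-nonNegative (neg-nonNegative 1≤0) (neg-nonNegative 1≤0))

  ⁻¹-nonNegative : ∀ {x} → 0# ≤ x → ¬ (x ≈ 0#) → 0# ≤ x ⁻¹
  ⁻¹-nonNegative {x} 0≤x x≉0 with total 0# (x ⁻¹)
  ... | inj₁ 0≤x⁻¹ = 0≤x⁻¹
  ... | inj₂ x⁻¹≤0 = contradiction (antisym 0≤1 1≤0) 0≉1
    where
    1≤0 : 1# ≤ 0#
    1≤0 = begin
      1#        ≈⟨ ⁻¹-inverseʳ x x≉0 ⟨
      x * x ⁻¹  ≈⟨ *-comm x (x ⁻¹) ⟩
      x ⁻¹ * x  ≤⟨ *-monoˡ-≤ 0≤x x⁻¹≤0 ⟩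
      0# * x    ≈⟨ zeroˡ x ⟩
      0#        ∎

  *-÷-cancel : ∀ x {y} → ¬ (y ≈ 0#) → x * y ÷ y ≈ x
  *-÷-cancel x {y} y≉0 = ≈.trans (*-assoc x y (y ⁻¹))
    (≈.trans (*-congˡ (⁻¹-inverseʳ y y≉0)) (*-identityʳ x))

  ÷-*-cancel : ∀ x {y} → ¬ (y ≈ 0#) → x ÷ y * y ≈ x
  ÷-*-cancel x {y} y≉0 = ≈.trans (*-assoc x (y ⁻¹) y)
    (≈.trans (*-congˡ (*-comm (y ⁻¹) y)) (≈.trans (≈.sym (*-assoc x y (y ⁻¹))) (*-÷-cancel x y≉0)))

  0≤x⇒∣x∣≈x : ∀ {x} → 0# ≤ x → ∣ x ∣ ≈ x
  0≤x⇒∣x∣≈x {x} 0≤x with 0# ≤? x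
  ... | yes _   = ≈.refl
  ... | no  0≰x = contradiction 0≤x 0≰x

  x≤0⇒∣x∣≈-x : ∀ {x} → x ≤ 0# → ∣ x ∣ ≈ - x
  x≤0⇒∣x∣≈-x {x} x≤0 with 0# ≤? x
  ... | no  _   = ≈.refl
  ... | yes 0≤x = ≈.trans x≈0 (≈.trans (≈.sym -0#≈0#) (-‿cong (≈.sym x≈0)))
    where x≈0 = antisym x≤0 0≤x

  y≤x⇒∣x-y∣≈x-y : ∀ {x y} → y ≤ x → ∣ x - y ∣ ≈ x - y
  y≤x⇒∣x-y∣≈x-y y≤x = 0≤x⇒∣x∣≈x (0≤y-x y≤x)

  x≤y⇒∣x-y∣≈y-x : ∀ {x y} → x ≤ y → ∣ x - y ∣ ≈ y - x
  x≤y⇒∣x-y∣≈y-x {x} {y} x≤y = ≈.trans (x≤0⇒∣x∣≈-x x-y≤0) (⁻¹-anti-homo‿- x y)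
    where
    x-y≤0 = ≤-respʳ-≈ (-‿inverseʳ y) (+-monoˡ-≤ (- y) x≤y)

  ∣x∣-nonNegative : ∀ x → 0# ≤ ∣ x ∣
  ∣x∣-nonNegative x with total 0# x
  ... | inj₁ 0≤x = ≤-respʳ-≈ (≈.sym (0≤x⇒∣x∣≈x 0≤x)) 0≤x
  ... | inj₂ x≤0 = ≤-respʳ-≈ (≈.sym (x≤0⇒∣x∣≈-x x≤0)) (neg-nonNegative x≤0)

  [y-x]+[z-y]≈z-x : ∀ x y z → (y - x) + (z - y) ≈ z - x
  [y-x]+[z-y]≈z-x x y z = ≈.trans (+-comm (y - x) (z - y))
    (≈.trans (+-assoc z (- y) (y - x))
      (+-congˡ (≈.trans (≈.sym (+-assoc (- y) y (- x)))
        (≈.trans (+-congʳ (-‿inverseˡ y)) (+-identityˡ (- x))))))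

-- Reduction of the Lipschitz constant to consecutive ratios.

module ConsecutiveRatios {c ℓ₁ ℓ₂ m ℓ} (ℝ : RealNumbers c ℓ₁ ℓ₂) {n : ℕ}
         (P : PointSet ℝ n) (M : MetricSpace ℝ m ℓ)
         (f : Fin n → MetricSpace.Carrier M) where
  open RealNumbers ℝ
  open OrderedField ℝ
  open PointSet P
  open MetricSpace M using (ρ; isMetric)
  module ρ = IsGeneralMetric isMetric
  open PosetReasoning poset

  pointOrder : DecTotalOrder _ _ _
  pointOrder = On.decTotalOrder decTotalOrder point

  open DecTotalOrder pointOrder public using () renaming (_≤_ to _≼_)

  -- The denominator is signed, as in the program, so this is the stretch of a pair only when
  -- `i ≼ j`.
  ratio : Fin n → Fin n → Carrier
  ratio i j = ρ (f i) (f j) ÷ (point j - point i)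

  ρ[x,x]≈0 : ∀ i → ρ (f i) (f i) ≈ 0#
  ρ[x,x]≈0 i = ρ.≈⇒0 ρ.EqC.refl

  gap≉0 : ∀ {i j} → ¬ (i ≡ j) → ¬ (point j - point i ≈ 0#)
  gap≉0 {i} {j} i≢j gap≈0 = i≢j (≡.sym (distinct (x∙y⁻¹≈ε⇒x≈y (point j) (point i) gap≈0)))

  -- The minimality half: every admissible `K` dominates whatever the scan computes. For equal
  -- indices the ratio is 0 for any inverse of the zero gap, and `0 ≤ K` suffices.
  lipschitz⇒ratio≤ : ∀ {K} → 0# ≤ K → IsLipschitz ℝ P M f K → ∀ {i j} → i ≼ j → ratio i j ≤ K
  lipschitz⇒ratio≤ {K} 0≤K lip {i} {j} i≼j with i Fin.≟ j
  ... | yes ≡.refl = begin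
    ratio i i                       ≈⟨ *-congʳ (ρ[x,x]≈0 i) ⟩
    0# * (point i - point i) ⁻¹     ≈⟨ zeroˡ _ ⟩
    0#                              ≤⟨ 0≤K ⟩
    K                               ∎
  ... | no i≢j = begin
    ρ (f i) (f j) ÷ gap             ≤⟨ *-monoˡ-≤ (⁻¹-nonNegative (0≤y-x i≼j) (gap≉0 i≢j)) (lip i j) ⟩
    K * ∣ point i - point j ∣ ÷ gap  ≈⟨ *-congʳ (*-congˡ (x≤y⇒∣x-y∣≈y-x i≼j)) ⟩
    K * gap ÷ gap                   ≈⟨ *-÷-cancel K (gap≉0 i≢j) ⟩
    K                               ∎
    where gap = point j - point i

  -- The order is carried along so that the signed gap can be turned into an absolute value after
  -- chaining.
  Stretch≤ : Carrier → Fin n → Fin n → Set ℓ₂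
  Stretch≤ K i j = i ≼ j × ρ (f i) (f j) ≤ K * (point j - point i)

  ratio≤⇒stretch≤ : ∀ {K i j} → i ≼ j → ratio i j ≤ K → Stretch≤ K i j
  ratio≤⇒stretch≤ {K} {i} {j} i≼j r≤K = i≼j , bound
    where
    gap = point j - point i
    bound : ρ (f i) (f j) ≤ K * gap
    bound with i Fin.≟ j
    ... | yes ≡.refl = begin
      ρ (f i) (f i)  ≈⟨ ρ[x,x]≈0 i ⟩
      0#             ≈⟨ zeroʳ K ⟨
      K * 0#         ≈⟨ *-congˡ (-‿inverseʳ (point i)) ⟨
      K * gap        ∎
    ... | no i≢j = begin
      ρ (f i) (f j)    ≈⟨ ÷-*-cancel _ (gap≉0 i≢j) ⟨
      ratio i j * gap  ≤⟨ *-monoˡ-≤ (0≤y-x i≼j) r≤K ⟩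
      K * gap          ∎

  -- Triangle inequality on the left, telescoping gaps on the right.
  stretch≤-trans : ∀ {K} → Transitive (Stretch≤ K)
  stretch≤-trans {K} {i} {j} {k} (i≼j , ρij≤) (j≼k , ρjk≤) = ≤-trans i≼j j≼k , (begin
    ρ (f i) (f k)                                          ≤⟨ ρ.triangle (f i) (f j) (f k) ⟩
    ρ (f i) (f j) + ρ (f j) (f k)                          ≤⟨ +-mono-≤ ρij≤ ρjk≤ ⟩
    K * (point j - point i) + K * (point k - point j)      ≈⟨ distribˡ K _ _ ⟨
    K * ((point j - point i) + (point k - point j))        ≈⟨ *-congˡ ([y-x]+[z-y]≈z-x _ _ _) ⟩
    K * (point k - point i)                                ∎)

  stretch≤⇒ρ≤ : ∀ {K i j} → Stretch≤ K i j → ρ (f i) (f j) ≤ K * ∣ point i - point j ∣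
  stretch≤⇒ρ≤ (i≼j , ρ≤) = ≤-respʳ-≈ (*-congˡ (≈.sym (x≤y⇒∣x-y∣≈y-x i≼j))) ρ≤

  stretch≤⇒ρ≤′ : ∀ {K i j} → Stretch≤ K j i → ρ (f i) (f j) ≤ K * ∣ point i - point j ∣
  stretch≤⇒ρ≤′ {i = i} {j} (j≼i , ρ≤) =
    ≤-respˡ-≈ (ρ.sym (f j) (f i)) (≤-respʳ-≈ (*-congˡ (≈.sym (y≤x⇒∣x-y∣≈x-y j≼i))) ρ≤)

  -- Transitivity turns bounds on neighbours into bounds on all pairs in list order. Any two indices
  -- occur in `xs`; symmetry of `ρ` covers the reverse order.
  consecutiveRatios≤⇒lipschitz : ∀ {K xs} → 0# ≤ K → Linked _≼_ xs →
    Linked (λ i j → ratio i j ≤ K) xs → (∀ i → i ∈ xs) → IsLipschitz ℝ P M f K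
  consecutiveRatios≤⇒lipschitz {K} {xs} 0≤K xs↗ ratios≤K complete i j =
    bound (AllPairs-∈ pairs (complete i) (complete j))
    where
    pairs = Linked⇒AllPairs (λ {x} {y} {z} → stretch≤-trans {K} {x} {y} {z})
              (Linked.zipWith (λ (i≼j , r≤K) → ratio≤⇒stretch≤ i≼j r≤K) (xs↗ , ratios≤K))
    bound : ∀ {i j} → i ≡ j ⊎ Stretch≤ K i j ⊎ Stretch≤ K j i →
            ρ (f i) (f j) ≤ K * ∣ point i - point j ∣
    bound {i} {j} (inj₁ ≡.refl)    = begin
      ρ (f i) (f i)              ≈⟨ ρ[x,x]≈0 i ⟩
      0#                         ≤⟨ *-nonNegative 0≤K (∣x∣-nonNegative _) ⟩
      K * ∣ point i - point i ∣  ∎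
    bound (inj₂ (inj₁ i→j)) = stretch≤⇒ρ≤ i→j
    bound (inj₂ (inj₂ j→i)) = stretch≤⇒ρ≤′ j→i

-- Lists and runs stored in arrays.

Agree : ℕ → (ℕ → ℕ) → (ℕ → ℕ) → Set
Agree u f g = ∀ {k} → k ℕ.< u → f k ≡ g k

agree-trans : ∀ {u f g h} → Agree u f g → Agree u g h → Agree u f h
agree-trans f≗g g≗h k<u = ≡.trans (f≗g k<u) (g≗h k<u)

agree-weaken : ∀ {u v f g} → u ℕ.≤ v → Agree v f g → Agree u f g
agree-weaken u≤v f≗g k<u = f≗g (ℕ.<-≤-trans k<u u≤v)

module _ {n : ℕ} where

  -- `hi` is exclusive. The shape of the list thus decides the comparison of `lo` with `hi`, and
  -- with it the loop tests.
  Segment : (ℕ → ℕ) → ℕ → ℕ → List (Fin n) → Set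
  Segment f lo hi []       = lo ≡ hi
  Segment f lo hi (x ∷ xs) = f lo ≡ toℕ x × Segment f (suc lo) hi xs

  segment⇒≤ : ∀ {f lo hi} xs → Segment f lo hi xs → lo ℕ.≤ hi
  segment⇒≤ []       ≡.refl    = ℕ.≤-refl
  segment⇒≤ (x ∷ xs) (_ , seg) = ℕ.<⇒≤ (segment⇒≤ xs seg)

  segment-agree : ∀ {f g lo hi} xs → Agree hi f g → Segment f lo hi xs → Segment g lo hi xs
  segment-agree []       f≗g seg        = seg
  segment-agree (x ∷ xs) f≗g (fx , seg) =
    ≡.trans (≡.sym (f≗g (segment⇒≤ xs seg))) fx , segment-agree xs f≗g seg

  Runs : (ℕ → ℕ) → (ℕ → ℕ) → ℕ → ℕ → List (List (Fin n)) → Set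
  Runs f s lo hi []         = lo ≡ hi
  Runs f s lo hi (xs ∷ xss) = Segment f (s lo) (s (suc lo)) xs × Runs f s (suc lo) hi xss

  runs⇒≤ : ∀ {f s lo hi} xss → Runs f s lo hi xss → lo ℕ.≤ hi
  runs⇒≤ []         ≡.refl     = ℕ.≤-refl
  runs⇒≤ (xs ∷ xss) (_ , runs) = ℕ.<⇒≤ (runs⇒≤ xss runs)

  runs⇒start≤ : ∀ {f s lo hi} xss → Runs f s lo hi xss → s lo ℕ.≤ s hi
  runs⇒start≤ []         ≡.refl       = ℕ.≤-refl
  runs⇒start≤ (xs ∷ xss) (seg , runs) = ℕ.≤-trans (segment⇒≤ xs seg) (runs⇒start≤ xss runs)

  -- Neighbouring runs share a boundary and the last run ends at `s hi`, so `s` has to agree at `hi`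
  -- as well. Boundaries increase, so `f` matters only below `s hi`.
  runs-agree : ∀ {f g s s′ lo hi} xss → Agree (s hi) f g → Agree (suc hi) s s′ →
               Runs f s lo hi xss → Runs g s′ lo hi xss
  runs-agree []         f≗g s≗s′ runs = runs
  runs-agree {f} {g} {s} {s′} {lo} {hi} (xs ∷ xss) f≗g s≗s′ (seg , runs) =
    ≡.subst₂ (λ u v → Segment g u v xs) (s≗s′ (ℕ.s≤s (ℕ.<⇒≤ lo<hi))) (s≗s′ (ℕ.s≤s lo<hi))
      (segment-agree xs (agree-weaken (runs⇒start≤ xss runs) f≗g) seg) ,
    runs-agree xss f≗g s≗s′ runs
    where lo<hi = runs⇒≤ xss runs

nth-toℕ : ∀ {a} {A : Set a} {n} d (v : Fin n → A) i → nth d v (toℕ i) ≡ v i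
nth-toℕ d v zero    = ≡.refl
nth-toℕ d v (suc i) = nth-toℕ d (v ∘ suc) i

write-same : ∀ {a} {A : Set a} b i (v : A) μ → write b i v μ b i ≡ v
write-same b i v μ
  rewrite dec-true (b ℕ.≟ b) ≡.refl | dec-true (i ℕ.≟ i) ≡.refl = ≡.refl

write-other : ∀ {a} {A : Set a} b i (v : A) μ {j} → ¬ (j ≡ i) → write b i v μ b j ≡ μ b j
write-other b i v μ {j} j≢i
  rewrite dec-true (b ℕ.≟ b) ≡.refl | dec-false (j ℕ.≟ i) j≢i = ≡.refl

write-agree : ∀ b i v μ → Agree i (μ b) (write b i v μ b)
write-agree b i v μ k<i = ≡.sym (write-other b i v μ (ℕ.<⇒≢ k<i))

-- The program.

var : ℕ → ℕExp
var a = a [ lit 0 ]ᴺ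

-- The k-th run occupies the tape cells from start k up to start (k + 1);
-- those not yet merged are numbered from head to end - 1, and the first
-- unwritten cell, free, equals start end except while a merge is under way.
-- Arrays are numbered so that the merge loop modifies only arrays 0 to 3.
tape start : ℕExp → ℕExp
tape  = 0 [_]ᴺ
start = 4 [_]ᴺ

free left right leftEnd rightEnd head end passEnd : ℕExp
free     = var 1
left     = var 2
right    = var 3
leftEnd  = var 5
rightEnd = var 6
head     = var 7
end      = var 8
passEnd  = var 9

-- Disjunctions are written through negated conjunctions. `takeLeft` asks for a nonempty left run
-- and, in addition, an exhausted right run or a left element that is at most the right one.
mergeGuard takeLeft : Test
mergeGuard = notᵀ ((leftEnd ≤ᴺ left) ∧ᵀ (rightEnd ≤ᴺ right))
takeLeft   = notᵀ (leftEnd ≤ᴺ left) ∧ᵀ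
             notᵀ (notᵀ (rightEnd ≤ᴺ right) ∧ᵀ notᵀ (input (tape left) ≤ᴿ input (tape right)))

mergeBody mergeLoop : Program
mergeBody =
  if takeLeft then
    0 [ free ]ᴺ≔ tape left ⨾
    2 [ lit 0 ]ᴺ≔ lit 1 ⊕ left
  else
    0 [ free ]ᴺ≔ tape right ⨾
    3 [ lit 0 ]ᴺ≔ lit 1 ⊕ right
  end ⨾
  1 [ lit 0 ]ᴺ≔ lit 1 ⊕ free
mergeLoop = while mergeGuard loop mergeBody

passGuard : Test
passGuard = lit 1 ⊕ head ≤ᴺ passEnd

-- The last assignment to head computes min (head + 2) passEnd, so that
-- an unpaired last run is merged with an empty one.
pairSetup pairFinish passBody passLoop : Program
pairSetup =
  2 [ lit 0 ]ᴺ≔ start head ⨾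
  5 [ lit 0 ]ᴺ≔ start (lit 1 ⊕ head) ⨾
  3 [ lit 0 ]ᴺ≔ leftEnd ⨾
  7 [ lit 0 ]ᴺ≔ passEnd ⊖ (passEnd ⊖ (lit 2 ⊕ head)) ⨾
  6 [ lit 0 ]ᴺ≔ start head
pairFinish =
  8 [ lit 0 ]ᴺ≔ lit 1 ⊕ end ⨾
  4 [ end ]ᴺ≔ free
passBody = pairSetup ⨾ mergeLoop ⨾ pairFinish
passLoop = while passGuard loop passBody

sortGuard : Test
sortGuard = lit 2 ⊕ head ≤ᴺ end

setEnd sortBody sortLoop : Program
setEnd   = 9 [ lit 0 ]ᴺ≔ end
sortBody = setEnd ⨾ passLoop
sortLoop = while sortGuard loop sortBody

initGuard : Test
initGuard = lit 1 ⊕ free ≤ᴺ size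

initBody initLoop storeCount initRuns : Program
initBody =
  0 [ free ]ᴺ≔ free ⨾
  1 [ lit 0 ]ᴺ≔ lit 1 ⊕ free ⨾
  4 [ free ]ᴺ≔ free
initLoop = while initGuard loop initBody
storeCount = 8 [ lit 0 ]ᴺ≔ free
initRuns = initLoop ⨾ storeCount

scanGuard : Test
scanGuard = lit 2 ⊕ left ≤ᴺ free

ratioᴿ : ℝExp
ratioᴿ = dist (tape left) (tape (lit 1 ⊕ left)) ÷ᴿ (input (tape (lit 1 ⊕ left)) -ᴿ input (tape left))

rewind clear scanBody scanLoop scan : Program
rewind = 2 [ lit 0 ]ᴺ≔ start head
clear  = 0 [ lit 0 ]ᴿ≔ 0ᴿ
scanBody =
  if ratioᴿ ≤ᴿ 0 [ lit 0 ]ᴿ then skip else 0 [ lit 0 ]ᴿ≔ ratioᴿ end ⨾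
  2 [ lit 0 ]ᴺ≔ lit 1 ⊕ left
scanLoop = while scanGuard loop scanBody
scan = rewind ⨾ clear ⨾ scanLoop

lipschitzProgram : Program
lipschitzProgram = initRuns ⨾ sortLoop ⨾ scan

-- Time bounds and their asymptotics.

-- The running time when every loop exits at once; a bound on it when
-- the branches of a conditional differ in cost.
entryCost : Program → ℕ
entryCost skip                   = 1
entryCost (a [ d ]ᴺ≔ e)          = 1 ℕ.+ costᴺ d ℕ.+ costᴺ e
entryCost (a [ d ]ᴿ≔ r)          = 1 ℕ.+ costᴺ d ℕ.+ costᴿ r
entryCost (p ⨾ q)                = entryCost p ℕ.+ entryCost q
entryCost (if b then p else q end) = costᵀ b ℕ.+ (entryCost p ℕ.⊔ entryCost q)
entryCost (while b loop p)       = costᵀ b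

iterationCost : Test → Program → ℕ
iterationCost b p = costᵀ b ℕ.+ entryCost p

mergeStep passStep initStep scanStep : ℕ
mergeStep = iterationCost mergeGuard mergeBody
passStep  = iterationCost passGuard passBody
initStep  = iterationCost initGuard initBody
scanStep  = iterationCost scanGuard scanBody

-- A merge iteration accounts for one of at most `n` indices, a pass iteration for one of at most
-- `n` new runs. The last summand is the fixed cost of a round, including the failing pass test.
roundTime : ℕ → ℕ
roundTime n = n ℕ.* mergeStep ℕ.+ n ℕ.* passStep ℕ.+ iterationCost sortGuard sortBody

sortTime : ℕ → ℕ → ℕ
sortTime n k = k ℕ.* roundTime n ℕ.+ costᵀ sortGuard

initTime scanTime : ℕ → ℕ
initTime n = n ℕ.* initStep ℕ.+ entryCost initRuns
scanTime n = n ℕ.* scanStep ℕ.+ entryCost scan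

-- Halving lowers both logarithms by one, and half of `suc n` rounded up is by computation `suc` of
-- half of `n` rounded down, so the claim reproduces itself.
⌈log₂1+n⌉≤1+⌊log₂n⌋ : ∀ n → ⌈log₂ suc n ⌉ ℕ.≤ suc ⌊log₂ n ⌋
⌈log₂1+n⌉≤1+⌊log₂n⌋ = <-rec _ bound
  where
  bound : ∀ n → (∀ {m} → m ℕ.< n → ⌈log₂ suc m ⌉ ℕ.≤ suc ⌊log₂ m ⌋) → ⌈log₂ suc n ⌉ ℕ.≤ suc ⌊log₂ n ⌋
  bound 0 rec = ℕ.z≤n
  bound 1 rec = ℕ.≤-refl
  bound n@(suc (suc m)) rec = begin
    ⌈log₂ suc n ⌉                  ≤⟨ ℕ.m≤n+m∸n ⌈log₂ suc n ⌉ 1 ⟩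
    suc (⌈log₂ suc n ⌉ ℕ.∸ 1)      ≡⟨ ≡.cong suc (⌈log₂⌈n/2⌉⌉≡⌈log₂n⌉∸1 (suc n)) ⟨
    suc ⌈log₂ suc ℕ.⌊ n /2⌋ ⌉      ≤⟨ ℕ.s≤s (rec (ℕ.⌊n/2⌋<n (suc m))) ⟩
    suc (suc ⌊log₂ ℕ.⌊ n /2⌋ ⌋)    ≡⟨ ≡.cong (λ k → suc (suc k)) (⌊log₂⌊n/2⌋⌋≡⌊log₂n⌋∸1 n) ⟩
    suc (suc (⌊log₂ n ⌋ ℕ.∸ 1))    ≡⟨ ≡.cong suc (ℕ.m+[n∸m]≡n 1≤log) ⟩
    suc ⌊log₂ n ⌋                  ∎
    where
    open ℕ.≤-Reasoning
    1≤log : 1 ℕ.≤ ⌊log₂ n ⌋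
    1≤log = ⌊log₂⌋-mono-≤ {2} {n} (ℕ.s≤s (ℕ.s≤s ℕ.z≤n))

-- The threshold is 2 because the right side vanishes at 1. From there on `1 ≤ l`, so `n ≤ n * l`
-- absorbs the linear and constant terms and `k ≤ 1 + l ≤ 2 * l` gives the factor 2.
nlogn-bound : ∀ a b c d →
  (λ n → n ℕ.* a ℕ.+ ⌈log₂ n ⌉ ℕ.* (n ℕ.* b ℕ.+ c) ℕ.+ d) ∈O (λ n → n ℕ.* ⌊log₂ n ⌋)
nlogn-bound a b c d = a ℕ.+ 2 ℕ.* (b ℕ.+ c) ℕ.+ d , 2 , bound
  where
  open ℕ.≤-Reasoning
  factor : ∀ n l a b c d → n ℕ.* l ℕ.* a ℕ.+ (l ℕ.+ l) ℕ.* (n ℕ.* b ℕ.+ n ℕ.* c) ℕ.+ n ℕ.* l ℕ.* d ≡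
           (a ℕ.+ 2 ℕ.* (b ℕ.+ c) ℕ.+ d) ℕ.* (n ℕ.* l)
  factor = solve-∀
  bound : ∀ n → 2 ℕ.≤ n → n ℕ.* a ℕ.+ ⌈log₂ n ⌉ ℕ.* (n ℕ.* b ℕ.+ c) ℕ.+ d ℕ.≤
          (a ℕ.+ 2 ℕ.* (b ℕ.+ c) ℕ.+ d) ℕ.* (n ℕ.* ⌊log₂ n ⌋)
  bound n 2≤n = begin
    n ℕ.* a ℕ.+ k ℕ.* (n ℕ.* b ℕ.+ c) ℕ.+ d
      ≡⟨ ≡.cong₂ (λ u v → n ℕ.* a ℕ.+ k ℕ.* (n ℕ.* b ℕ.+ u) ℕ.+ v) (ℕ.*-identityˡ c) (ℕ.*-identityˡ d) ⟨
    n ℕ.* a ℕ.+ k ℕ.* (n ℕ.* b ℕ.+ 1 ℕ.* c) ℕ.+ 1 ℕ.* d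
      ≤⟨ ℕ.+-mono-≤ (ℕ.+-mono-≤ (ℕ.*-monoˡ-≤ a n≤nl)
           (ℕ.*-mono-≤ k≤l+l (ℕ.+-monoʳ-≤ (n ℕ.* b) (ℕ.*-monoˡ-≤ c 1≤n))))
           (ℕ.*-monoˡ-≤ d (ℕ.≤-trans 1≤n n≤nl)) ⟩
    n ℕ.* l ℕ.* a ℕ.+ (l ℕ.+ l) ℕ.* (n ℕ.* b ℕ.+ n ℕ.* c) ℕ.+ n ℕ.* l ℕ.* d
      ≡⟨ factor n l a b c d ⟩
    (a ℕ.+ 2 ℕ.* (b ℕ.+ c) ℕ.+ d) ℕ.* (n ℕ.* l) ∎
    where
    k = ⌈log₂ n ⌉
    l = ⌊log₂ n ⌋
    1≤n : 1 ℕ.≤ n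
    1≤n = ℕ.≤-trans (ℕ.n≤1+n 1) 2≤n
    1≤l : 1 ℕ.≤ l
    1≤l = ⌊log₂⌋-mono-≤ 2≤n
    n≤nl : n ℕ.≤ n ℕ.* l
    n≤nl = ℕ.m≤m*n n l {{ℕ.>-nonZero 1≤l}}
    k≤l+l : k ℕ.≤ l ℕ.+ l
    k≤l+l = ℕ.≤-trans (⌈log₂⌉-mono-≤ (ℕ.n≤1+n n)) (ℕ.≤-trans (⌈log₂1+n⌉≤1+⌊log₂n⌋ n) (ℕ.+-monoˡ-≤ l 1≤l))

runningTime : ℕ → ℕ
runningTime n = n ℕ.* (initStep ℕ.+ scanStep) ℕ.+
  ⌈log₂ n ⌉ ℕ.* (n ℕ.* (mergeStep ℕ.+ passStep) ℕ.+ iterationCost sortGuard sortBody) ℕ.+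
  (entryCost initRuns ℕ.+ costᵀ sortGuard ℕ.+ entryCost scan)

runningTime∈O : runningTime ∈O (λ n → n ℕ.* ⌊log₂ n ⌋)
runningTime∈O = nlogn-bound (initStep ℕ.+ scanStep) (mergeStep ℕ.+ passStep)
  (iterationCost sortGuard sortBody) (entryCost initRuns ℕ.+ costᵀ sortGuard ℕ.+ entryCost scan)

phases≡runningTime : ∀ n → initTime n ℕ.+ (sortTime n ⌈log₂ n ⌉ ℕ.+ scanTime n) ≡ runningTime n
phases≡runningTime n = expand n ⌈log₂ n ⌉ initStep (entryCost initRuns) mergeStep passStep
  (iterationCost sortGuard sortBody) (costᵀ sortGuard) scanStep (entryCost scan)
  where
  expand : ∀ n k a b c d e f g h →
    n ℕ.* a ℕ.+ b ℕ.+ (k ℕ.* (n ℕ.* c ℕ.+ n ℕ.* d ℕ.+ e) ℕ.+ f ℕ.+ (n ℕ.* g ℕ.+ h)) ≡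
    n ℕ.* (a ℕ.+ g) ℕ.+ k ℕ.* (n ℕ.* (c ℕ.+ d) ℕ.+ e) ℕ.+ (b ℕ.+ f ℕ.+ h)
  expand = solve-∀

-- The truncated case of the minimum formula, met when `head + 2` overshoots `passEnd`.
m∸[m∸n]≡m : ∀ {m n} → m ℕ.≤ n → m ℕ.∸ (m ℕ.∸ n) ≡ m
m∸[m∸n]≡m {m} m≤n = ≡.cong (m ℕ.∸_) (ℕ.m≤n⇒m∸n≡0 m≤n)

-- Correctness and cost of the phases.

module Execution {c ℓ₁ ℓ₂ m ℓ} (ℝ : RealNumbers c ℓ₁ ℓ₂) {n : ℕ}
         (P : PointSet ℝ n) (M : MetricSpace ℝ m ℓ)
         (f : Fin n → MetricSpace.Carrier M) where
  open RealRAM ℝ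
  open RealNumbers ℝ using (0#; _≤_; _≤?_)
  open OrderedField ℝ using (≤-refl; ≤-trans; ≰⇒≥)
  open PointSet P using (point)
  open ConsecutiveRatios ℝ P M f
  open DecTotalOrder pointOrder using () renaming (_≤?_ to _≼?_)
  open MergeSort pointOrder using (mergePairs)
  open MergeSortProperties pointOrder using (mergePairs-↭; mergePairs-↗)

  I : Input n
  I = inputOf ℝ P M f

  infix 20 _⟦_⟧
  _⟦_⟧ : State → ℕExp → ℕ
  σ ⟦ d ⟧ = evalᴺ I d σ

  tapeOf startOf : State → ℕ → ℕ
  tapeOf  σ = ints σ 0
  startOf σ = ints σ 4

  -- A total-correctness triple for a fixed initial state. The time is only bounded, because the
  -- branch costs depend on the data.
  record Halts {q} (p : Program) (σ : State) (B : ℕ) (Q : State → Set q) : Set (c ⊔ q) where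
    constructor halts
    field
      {time}  : ℕ
      {final} : State
      run     : I ⊢⟨ p , σ ⟩⇓[ time ] final
      time≤   : time ℕ.≤ B
      post    : Q final

  while-step : ∀ {q q′ b p s σ σ′ C D} {Q : State → Set q} {R : State → Set q′} →
    evalᵀ I b σ ≡ true → I ⊢⟨ p , σ ⟩⇓[ s ] σ′ → costᵀ b ℕ.+ s ℕ.≤ C →
    (∀ {τ} → Q τ → R τ) → Halts (while b loop p) σ′ D Q → Halts (while b loop p) σ (C ℕ.+ D) R
  while-step b≡true run s≤C Q⇒R (halts rest t≤D q) =
    halts (while-true b≡true run rest) (ℕ.+-mono-≤ s≤C t≤D) (Q⇒R q)

  while-stop : ∀ {q b p σ} {Q : State → Set q} →
    evalᵀ I b σ ≡ false → Q σ → Halts (while b loop p) σ (costᵀ b) Q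
  while-stop b≡false q = halts (while-false b≡false) ℕ.≤-refl q

  weaken : ∀ {q p σ B C} {Q : State → Set q} → B ≡ C → Halts p σ B Q → Halts p σ C Q
  weaken ≡.refl h = h

  -- Merging two runs.

  record Appended (σ : State) (zs : List (Fin n)) (τ : State) : Set where
    constructor appended
    field
      written : Segment (tapeOf τ) (σ ⟦ free ⟧) (τ ⟦ free ⟧) zs
      kept    : Agree (σ ⟦ free ⟧) (tapeOf σ) (tapeOf τ)
      -- Comparing `4 ℕ.+ b` with an array number below 4 computes to false, so each iteration
      -- satisfies this by `refl`.
      frame   : ∀ b k → ints τ (4 ℕ.+ b) k ≡ ints σ (4 ℕ.+ b) k

  -- The remaining iterations keep every cell below their own `free`, including the one just
  -- written.
  appended-∷ : ∀ {σ σ′ τ z zs} → σ′ ⟦ free ⟧ ≡ suc (σ ⟦ free ⟧) →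
    tapeOf σ′ (σ ⟦ free ⟧) ≡ toℕ z → Agree (σ ⟦ free ⟧) (tapeOf σ) (tapeOf σ′) →
    (∀ b k → ints σ′ (4 ℕ.+ b) k ≡ ints σ (4 ℕ.+ b) k) →
    Appended σ′ zs τ → Appended σ (z ∷ zs) τ
  appended-∷ {σ} {σ′} {τ} {z} {zs} free′ pushed kept₁ frame₁ (appended written kept frame) = appended
    (≡.trans (≡.sym (kept free<)) pushed ,
     ≡.subst (λ u → Segment (tapeOf τ) u (τ ⟦ free ⟧) zs) free′ written)
    (agree-trans kept₁ (agree-weaken (ℕ.<⇒≤ free<) kept))
    (λ b k → ≡.trans (frame b k) (frame₁ b k))
    where
    free< : σ ⟦ free ⟧ ℕ.< σ′ ⟦ free ⟧
    free< = ℕ.≤-reflexive (≡.sym free′)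

  -- The bounds by `free` keep the unread parts of both runs clear of the cell being written.
  Merging : State → List (Fin n) → List (Fin n) → Set
  Merging σ xs ys =
    Segment (tapeOf σ) (σ ⟦ left ⟧) (σ ⟦ leftEnd ⟧) xs × σ ⟦ leftEnd ⟧ ℕ.≤ σ ⟦ free ⟧ ×
    Segment (tapeOf σ) (σ ⟦ right ⟧) (σ ⟦ rightEnd ⟧) ys × σ ⟦ rightEnd ⟧ ℕ.≤ σ ⟦ free ⟧

  mergeTime : List (Fin n) → ℕ
  mergeTime zs = length zs ℕ.* mergeStep ℕ.+ costᵀ mergeGuard

  MergeHalts : State → List (Fin n) → Set c
  MergeHalts σ zs = Halts mergeLoop σ (mergeTime zs) (Appended σ zs)

  ≥⇒≤?-true : ∀ {u v} → u ≡ v → does (v ℕ.≤? u) ≡ true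
  ≥⇒≤?-true {u} ≡.refl = dec-true (u ℕ.≤? u) ℕ.≤-refl

  <⇒≤?-false : ∀ {u v} → u ℕ.< v → does (v ℕ.≤? u) ≡ false
  <⇒≤?-false {u} {v} u<v = dec-false (v ℕ.≤? u) (ℕ.<⇒≱ u<v)

  merge-step : ∀ {σ σ′ z zs} → evalᵀ I mergeGuard σ ≡ true →
    I ⊢⟨ mergeBody , σ ⟩⇓[ entryCost mergeBody ] σ′ →
    (∀ {τ} → Appended σ′ zs τ → Appended σ (z ∷ zs) τ) →
    MergeHalts σ′ zs → MergeHalts σ (z ∷ zs)
  merge-step {zs = zs} guard run push rest =
    weaken (≡.sym (ℕ.+-assoc mergeStep (length zs ℕ.* mergeStep) (costᵀ mergeGuard)))
      (while-step guard run ℕ.≤-refl push rest)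

  afterLeft afterRight : State → State
  afterLeft σ = record σ { ints = write 1 0 (suc (σ ⟦ free ⟧)) (write 2 0 (suc (σ ⟦ left ⟧))
    (write 0 (σ ⟦ free ⟧) (σ ⟦ tape left ⟧) (ints σ))) }
  afterRight σ = record σ { ints = write 1 0 (suc (σ ⟦ free ⟧)) (write 3 0 (suc (σ ⟦ right ⟧))
    (write 0 (σ ⟦ free ⟧) (σ ⟦ tape right ⟧) (ints σ))) }

  keptLeft : ∀ σ → Agree (σ ⟦ free ⟧) (tapeOf σ) (tapeOf (afterLeft σ))
  keptLeft σ = write-agree 0 (σ ⟦ free ⟧) _ (ints σ)

  keptRight : ∀ σ → Agree (σ ⟦ free ⟧) (tapeOf σ) (tapeOf (afterRight σ))
  keptRight σ = write-agree 0 (σ ⟦ free ⟧) _ (ints σ)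

  step-left : ∀ {σ x xs ys zs} → Merging σ (x ∷ xs) ys → evalᵀ I takeLeft σ ≡ true →
    (Merging (afterLeft σ) xs ys → MergeHalts (afterLeft σ) zs) → MergeHalts σ (x ∷ zs)
  step-left {σ} {x} {xs} {ys} ((fx , segˡ) , ˡ≤ , segʳ , ʳ≤) take rest = merge-step guard
    (seq (if-true take (seq assignᴺ assignᴺ)) assignᴺ)
    (appended-∷ {σ} {afterLeft σ} ≡.refl (≡.trans (write-same 0 (σ ⟦ free ⟧) _ (ints σ)) fx)
      (keptLeft σ) (λ _ _ → ≡.refl))
    (rest (segment-agree xs (agree-weaken ˡ≤ (keptLeft σ)) segˡ , ℕ.m≤n⇒m≤1+n ˡ≤ ,
           segment-agree ys (agree-weaken ʳ≤ (keptLeft σ)) segʳ , ℕ.m≤n⇒m≤1+n ʳ≤))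
    where
    guard : evalᵀ I mergeGuard σ ≡ true
    guard rewrite <⇒≤?-false (segment⇒≤ xs segˡ) = ≡.refl

  step-right : ∀ {σ xs y ys zs} → Merging σ xs (y ∷ ys) → evalᵀ I takeLeft σ ≡ false →
    (Merging (afterRight σ) xs ys → MergeHalts (afterRight σ) zs) → MergeHalts σ (y ∷ zs)
  step-right {σ} {xs} {y} {ys} (segˡ , ˡ≤ , (fy , segʳ) , ʳ≤) take rest = merge-step guard
    (seq (if-false take (seq assignᴺ assignᴺ)) assignᴺ)
    (appended-∷ {σ} {afterRight σ} ≡.refl (≡.trans (write-same 0 (σ ⟦ free ⟧) _ (ints σ)) fy)
      (keptRight σ) (λ _ _ → ≡.refl))
    (rest (segment-agree xs (agree-weaken ˡ≤ (keptRight σ)) segˡ , ℕ.m≤n⇒m≤1+n ˡ≤ ,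
           segment-agree ys (agree-weaken ʳ≤ (keptRight σ)) segʳ , ℕ.m≤n⇒m≤1+n ʳ≤))
    where
    guard : evalᵀ I mergeGuard σ ≡ true
    guard rewrite <⇒≤?-false (segment⇒≤ ys segʳ) | ∧-zeroʳ (does (σ ⟦ leftEnd ⟧ ℕ.≤? σ ⟦ left ⟧)) = ≡.refl

  -- The machine test evaluates to the very decision on which `merge` branches, so one case split
  -- settles the control flow and the list together.
  step-both : ∀ {σ x xs y ys} → Merging σ (x ∷ xs) (y ∷ ys) →
    (∀ σ → Merging σ xs (y ∷ ys) → MergeHalts σ (merge _≼?_ xs (y ∷ ys))) →
    (∀ σ → Merging σ (x ∷ xs) ys → MergeHalts σ (merge _≼?_ (x ∷ xs) ys)) →
    MergeHalts σ (merge _≼?_ (x ∷ xs) (y ∷ ys))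
  step-both {σ} {x} {xs} {y} {ys} inv@((fx , segˡ) , _ , (fy , segʳ) , _) recˡ recʳ = choose
    where
    takeLeft≡ : evalᵀ I takeLeft σ ≡ does (x ≼? y)
    takeLeft≡ rewrite <⇒≤?-false (segment⇒≤ xs segˡ) | <⇒≤?-false (segment⇒≤ ys segʳ)
      | fx | fy | nth-toℕ 0# point x | nth-toℕ 0# point y = not-involutive _
    choose : MergeHalts σ (merge _≼?_ (x ∷ xs) (y ∷ ys))
    choose with does (x ≼? y) | takeLeft≡
    ... | true  | take = step-left {ys = y ∷ ys} inv take (recˡ _)
    ... | false | take = step-right {xs = x ∷ xs} inv take (recʳ _)

  merge-halts : ∀ xs ys σ → Merging σ xs ys → MergeHalts σ (merge _≼?_ xs ys)
  merge-halts [] [] σ (left≡ , _ , right≡ , _) =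
    while-stop guard (appended ≡.refl (λ _ → ≡.refl) (λ _ _ → ≡.refl))
    where
    guard : evalᵀ I mergeGuard σ ≡ false
    guard rewrite ≥⇒≤?-true left≡ | ≥⇒≤?-true right≡ = ≡.refl
  merge-halts [] (y ∷ ys) σ inv@(left≡ , _) = step-right {xs = []} inv take (merge-halts [] ys _)
    where
    take : evalᵀ I takeLeft σ ≡ false
    take rewrite ≥⇒≤?-true left≡ = ≡.refl
  merge-halts (x ∷ xs) [] σ inv@((_ , segˡ) , _ , right≡ , _) =
    step-left {ys = []} inv take (≡.subst (MergeHalts _) (merge-[]ʳ _≼?_ xs) ∘ merge-halts xs [] _)
    where
    take : evalᵀ I takeLeft σ ≡ true
    take rewrite <⇒≤?-false (segment⇒≤ xs segˡ) | ≥⇒≤?-true right≡ = ≡.refl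
  merge-halts (x ∷ xs) (y ∷ ys) σ inv =
    step-both {xs = xs} {ys = ys} inv (merge-halts xs (y ∷ ys)) (merge-halts (x ∷ xs) ys)

  -- One pass over the pending runs.

  nextHead : State → ℕ
  nextHead σ = σ ⟦ passEnd ⊖ (passEnd ⊖ (lit 2 ⊕ head)) ⟧

  record Paired (σ : State) (zs : List (Fin n)) (τ : State) : Set where
    constructor paired
    field
      written    : Segment (tapeOf τ) (σ ⟦ free ⟧) (τ ⟦ free ⟧) zs
      kept       : Agree (σ ⟦ free ⟧) (tapeOf σ) (tapeOf τ)
      -- Cell `end` of `start` already holds the beginning of the run being written; `pairFinish`
      -- writes the cell after it.
      keptStarts : Agree (suc (σ ⟦ end ⟧)) (startOf σ) (startOf τ)
      end′       : τ ⟦ end ⟧ ≡ suc (σ ⟦ end ⟧)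
      start′     : startOf τ (τ ⟦ end ⟧) ≡ τ ⟦ free ⟧
      head′      : τ ⟦ head ⟧ ≡ nextHead σ
      passEnd′   : τ ⟦ passEnd ⟧ ≡ σ ⟦ passEnd ⟧

  afterSetup : State → State
  afterSetup σ = record σ { ints = write 6 0 (startOf σ (nextHead σ)) (write 7 0 (nextHead σ)
    (write 3 0 (σ ⟦ start (lit 1 ⊕ head) ⟧) (write 5 0 (σ ⟦ start (lit 1 ⊕ head) ⟧)
    (write 2 0 (σ ⟦ start head ⟧) (ints σ))))) }

  afterFinish : State → State
  afterFinish σ = record σ { ints = write 4 (suc (σ ⟦ end ⟧)) (σ ⟦ free ⟧)
    (write 8 0 (suc (σ ⟦ end ⟧)) (ints σ)) }

  -- The setup changes variables only, so the given segments are, by computation, also segments in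
  -- `afterSetup σ`.
  pair-halts : ∀ σ xs ys →
    Segment (tapeOf σ) (startOf σ (σ ⟦ head ⟧)) (startOf σ (suc (σ ⟦ head ⟧))) xs →
    Segment (tapeOf σ) (startOf σ (suc (σ ⟦ head ⟧))) (startOf σ (nextHead σ)) ys →
    startOf σ (nextHead σ) ℕ.≤ σ ⟦ free ⟧ →
    let zs = merge _≼?_ xs ys in
    Halts passBody σ (length zs ℕ.* mergeStep ℕ.+ entryCost passBody) (Paired σ zs)
  pair-halts σ xs ys segˡ segʳ ≤free
    with halts {time} {τ} run time≤ (appended written kept frame) ←
      merge-halts xs ys (afterSetup σ) (segˡ , ℕ.≤-trans (segment⇒≤ ys segʳ) ≤free , segʳ , ≤free)
    = halts (seq (seq assignᴺ (seq assignᴺ (seq assignᴺ (seq assignᴺ assignᴺ)))) (seq run (seq assignᴺ assignᴺ)))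
        bound
        -- Offsets 4, 3 and 5 of the frame are arrays 8, 7 and 9: `end`, `head` and `passEnd`.
        (paired written kept keptStarts (≡.cong suc (frame 4 0)) (write-same 4 _ _ (ints τ)) (frame 3 0) (frame 5 0))
    where
    zs = merge _≼?_ xs ys
    keptStarts : Agree (suc (σ ⟦ end ⟧)) (startOf σ) (startOf (afterFinish τ))
    keptStarts k< = ≡.trans (≡.sym (frame 0 _))
      (write-agree 4 (suc (τ ⟦ end ⟧)) _ (ints τ) (≡.subst (λ u → _ ℕ.< suc u) (≡.sym (frame 4 0)) k<))
    bound : entryCost pairSetup ℕ.+ (time ℕ.+ entryCost pairFinish) ℕ.≤
            length zs ℕ.* mergeStep ℕ.+ entryCost passBody
    bound = begin
      entryCost pairSetup ℕ.+ (time ℕ.+ entryCost pairFinish)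
        ≤⟨ ℕ.+-monoʳ-≤ (entryCost pairSetup) (ℕ.+-monoˡ-≤ (entryCost pairFinish) time≤) ⟩
      entryCost pairSetup ℕ.+ (length zs ℕ.* mergeStep ℕ.+ costᵀ mergeGuard ℕ.+ entryCost pairFinish)
        ≡⟨ rearrange (entryCost pairSetup) (length zs ℕ.* mergeStep) (costᵀ mergeGuard) (entryCost pairFinish) ⟩
      length zs ℕ.* mergeStep ℕ.+ entryCost passBody ∎
      where
      open ℕ.≤-Reasoning
      rearrange : ∀ a b c d → a ℕ.+ (b ℕ.+ c ℕ.+ d) ≡ b ℕ.+ (a ℕ.+ (c ℕ.+ d))
      rearrange = solve-∀

  passTime : List (List (Fin n)) → ℕ
  passTime []         = costᵀ passGuard
  passTime (zs ∷ zss) = length zs ℕ.* mergeStep ℕ.+ passStep ℕ.+ passTime zss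

  record Passed (σ : State) (zss : List (List (Fin n))) (τ : State) : Set where
    constructor passed
    field
      runs       : Runs (tapeOf τ) (startOf τ) (σ ⟦ end ⟧) (τ ⟦ end ⟧) zss
      kept       : Agree (σ ⟦ free ⟧) (tapeOf σ) (tapeOf τ)
      keptStarts : Agree (suc (σ ⟦ end ⟧)) (startOf σ) (startOf τ)
      start′     : startOf τ (τ ⟦ end ⟧) ≡ τ ⟦ free ⟧
      head′      : τ ⟦ head ⟧ ≡ σ ⟦ passEnd ⟧

  passed-∷ : ∀ {σ σ′ τ zs zss} → startOf σ (σ ⟦ end ⟧) ≡ σ ⟦ free ⟧ →
    Paired σ zs σ′ → Passed σ′ zss τ → Passed σ (zs ∷ zss) τ
  passed-∷ {σ} {σ′} {τ} {zs} {zss} start≡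
    (paired written kept₁ starts₁ end₁ start₁ head₁ passEnd₁) (passed runs kept starts start′ head′) = passed
    (≡.subst₂ (λ u v → Segment (tapeOf τ) u v zs)
       (≡.trans (≡.sym start≡) (≡.trans (starts₁ ℕ.≤-refl) (starts end<)))
       (≡.trans (≡.sym start₁) (≡.trans (starts ℕ.≤-refl) (≡.cong (startOf τ) end₁)))
       (segment-agree zs kept written) ,
     ≡.subst (λ u → Runs (tapeOf τ) (startOf τ) u (τ ⟦ end ⟧) zss) end₁ runs)
    (agree-trans kept₁ (agree-weaken (segment⇒≤ zs written) kept))
    (agree-trans starts₁ (agree-weaken end< starts))
    start′ (≡.trans head′ passEnd₁)
    where
    end< : suc (σ ⟦ end ⟧) ℕ.≤ suc (σ′ ⟦ end ⟧)
    end< = ℕ.s≤s (ℕ.≤-trans (ℕ.n≤1+n _) (ℕ.≤-reflexive (≡.sym end₁)))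

  -- The pending runs lie below `free` and their numbers below `end`, so neither new cells nor new
  -- boundaries disturb them.
  record Passing (σ : State) (xss : List (List (Fin n))) : Set where
    constructor passing
    field
      runs     : Runs (tapeOf σ) (startOf σ) (σ ⟦ head ⟧) (σ ⟦ passEnd ⟧) xss
      passEnd≤ : σ ⟦ passEnd ⟧ ℕ.≤ σ ⟦ end ⟧
      ≤free    : startOf σ (σ ⟦ passEnd ⟧) ℕ.≤ σ ⟦ free ⟧
      start≡   : startOf σ (σ ⟦ end ⟧) ≡ σ ⟦ free ⟧

  passing-step : ∀ {σ σ′ zs xss} → Passing σ xss → Paired σ zs σ′ →
    ∀ yss → Runs (tapeOf σ) (startOf σ) (nextHead σ) (σ ⟦ passEnd ⟧) yss → Passing σ′ yss
  passing-step {σ} {σ′} {zs} (passing _ passEnd≤ ≤free _)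
    (paired written kept starts end′ start′ head′ passEnd′) yss runs = passing
    (≡.subst₂ (λ u v → Runs (tapeOf σ′) (startOf σ′) u v yss) (≡.sym head′) (≡.sym passEnd′)
      (runs-agree yss (agree-weaken ≤free kept) (agree-weaken (ℕ.s≤s passEnd≤) starts) runs))
    (≡.subst₂ ℕ._≤_ (≡.sym passEnd′) (≡.sym end′) (ℕ.m≤n⇒m≤1+n passEnd≤))
    (≡.subst (ℕ._≤ σ′ ⟦ free ⟧)
      (≡.trans (starts (ℕ.s≤s passEnd≤)) (≡.cong (startOf σ′) (≡.sym passEnd′)))
      (ℕ.≤-trans ≤free (segment⇒≤ zs written)))
    start′

  PassHalts : State → List (List (Fin n)) → Set c
  PassHalts σ zss = Halts passLoop σ (passTime zss) (Passed σ zss)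

  pass-∷ : ∀ {σ xss zs zss} yss → Passing σ xss → suc (σ ⟦ head ⟧) ℕ.≤ σ ⟦ passEnd ⟧ →
    Halts passBody σ (length zs ℕ.* mergeStep ℕ.+ entryCost passBody) (Paired σ zs) →
    Runs (tapeOf σ) (startOf σ) (nextHead σ) (σ ⟦ passEnd ⟧) yss →
    (∀ σ′ → Passing σ′ yss → PassHalts σ′ zss) → PassHalts σ (zs ∷ zss)
  pass-∷ {σ} {zs = zs} yss inv more (halts run time≤ pair) runs rest =
    while-step (dec-true (_ ℕ.≤? _) more) run bound (passed-∷ (Passing.start≡ inv) pair)
      (rest _ (passing-step inv pair yss runs))
    where
    bound : costᵀ passGuard ℕ.+ _ ℕ.≤ length zs ℕ.* mergeStep ℕ.+ passStep
    bound = ℕ.≤-trans (ℕ.+-monoʳ-≤ (costᵀ passGuard) time≤)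
      (ℕ.≤-reflexive (x∙yz≈y∙xz (costᵀ passGuard) (length zs ℕ.* mergeStep) (entryCost passBody)))

  pass-halts : ∀ xss σ → Passing σ xss → PassHalts σ (mergePairs xss)
  pass-halts [] σ (passing head≡ _ _ start≡) =
    while-stop (dec-false (_ ℕ.≤? _) (λ head< → ℕ.<-irrefl head≡ head<))
      (passed ≡.refl (λ _ → ≡.refl) (λ _ → ≡.refl) start≡ head≡)
  -- Here `nextHead` is cut off at `passEnd`, which is `head + 1`: the right run is empty and the
  -- merge copies `xs`.
  pass-halts (xs ∷ []) σ inv@(passing (seg , head≡) _ ≤free _) =
    pass-∷ [] inv (ℕ.≤-reflexive head≡)
      (≡.subst (λ zs → Halts passBody σ (length zs ℕ.* mergeStep ℕ.+ entryCost passBody) (Paired σ zs))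
        (merge-[]ʳ _≼?_ xs)
        (pair-halts σ xs [] seg (≡.cong (startOf σ) (≡.trans head≡ (≡.sym next≡)))
          (≡.subst (λ u → startOf σ u ℕ.≤ σ ⟦ free ⟧) (≡.sym next≡) ≤free)))
      next≡
      (pass-halts [])
    where
    next≡ : nextHead σ ≡ σ ⟦ passEnd ⟧
    next≡ = m∸[m∸n]≡m (ℕ.m≤n⇒m≤1+n (ℕ.≤-reflexive (≡.sym head≡)))
  pass-halts (xs ∷ ys ∷ yss) σ inv@(passing (segˡ , segʳ , runs) _ ≤free _) =
    pass-∷ yss inv (ℕ.≤-trans (ℕ.n≤1+n _) next≤)
      (pair-halts σ xs ys segˡ
        (≡.subst (λ u → Segment (tapeOf σ) (startOf σ (suc (σ ⟦ head ⟧))) (startOf σ u) ys)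
          (≡.sym next≡) segʳ)
        (≡.subst (λ u → startOf σ u ℕ.≤ σ ⟦ free ⟧) (≡.sym next≡)
          (ℕ.≤-trans (runs⇒start≤ yss runs) ≤free)))
      (≡.subst (λ u → Runs (tapeOf σ) (startOf σ) u (σ ⟦ passEnd ⟧) yss) (≡.sym next≡) runs)
      (pass-halts yss)
    where
    next≤ : suc (suc (σ ⟦ head ⟧)) ℕ.≤ σ ⟦ passEnd ⟧
    next≤ = runs⇒≤ yss runs
    next≡ : nextHead σ ≡ suc (suc (σ ⟦ head ⟧))
    next≡ = ℕ.m∸[m∸n]≡n next≤

  passTime≡ : ∀ zss → passTime zss ≡
    length (concat zss) ℕ.* mergeStep ℕ.+ length zss ℕ.* passStep ℕ.+ costᵀ passGuard
  passTime≡ []         = ≡.refl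
  passTime≡ (zs ∷ zss) rewrite passTime≡ zss | length-++ zs {concat zss} =
    rearrange (length zs) (length (concat zss)) (length zss) mergeStep passStep (costᵀ passGuard)
    where
    rearrange : ∀ a b l x y z → a ℕ.* x ℕ.+ y ℕ.+ (b ℕ.* x ℕ.+ l ℕ.* y ℕ.+ z) ≡
                (a ℕ.+ b) ℕ.* x ℕ.+ (y ℕ.+ l ℕ.* y) ℕ.+ z
    rearrange = solve-∀

  passTime≤ : ∀ zss → length (concat zss) ℕ.≤ n → length zss ℕ.≤ n →
    passTime zss ℕ.≤ n ℕ.* mergeStep ℕ.+ n ℕ.* passStep ℕ.+ costᵀ passGuard
  passTime≤ zss total≤ count≤ = ℕ.≤-trans (ℕ.≤-reflexive (passTime≡ zss))
    (ℕ.+-monoˡ-≤ (costᵀ passGuard) (ℕ.+-mono-≤ (ℕ.*-monoˡ-≤ mergeStep total≤) (ℕ.*-monoˡ-≤ passStep count≤)))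

  length-mergePairs : ∀ xss → length (mergePairs xss) ≡ ℕ.⌈ length xss /2⌉
  length-mergePairs []              = ≡.refl
  length-mergePairs (xs ∷ [])       = ≡.refl
  length-mergePairs (xs ∷ ys ∷ xss) = ≡.cong suc (length-mergePairs xss)

  -- Rounds of merging.

  record Sorted (xss : List (List (Fin n))) (τ : State) : Set (c ⊔ ℓ₂) where
    constructor sorted
    field
      {contents} : List (Fin n)
      permuted   : contents ↭ concat xss
      ordered    : Linked _≼_ contents
      stored     : Segment (tapeOf τ) (startOf τ (τ ⟦ head ⟧)) (τ ⟦ free ⟧) contents

  record Sorting (σ : State) (xss : List (List (Fin n))) : Set (c ⊔ ℓ₂) where
    constructor sorting
    field
      runs    : Runs (tapeOf σ) (startOf σ) (σ ⟦ head ⟧) (σ ⟦ end ⟧) xss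
      start≡  : startOf σ (σ ⟦ end ⟧) ≡ σ ⟦ free ⟧
      ordered : All (Linked _≼_) xss
      total≤  : length (concat xss) ℕ.≤ n
      count≤  : length xss ℕ.≤ n

  afterSetEnd : State → State
  afterSetEnd σ = record σ { ints = write 9 0 (σ ⟦ end ⟧) (ints σ) }

  round-halts : ∀ σ xss → Sorting σ xss → Halts sortBody σ
    (n ℕ.* mergeStep ℕ.+ n ℕ.* passStep ℕ.+ entryCost sortBody) (λ τ → Sorting τ (mergePairs xss))
  round-halts σ xss (sorting runs start≡ xss↗ total≤ count≤) = continue
    (pass-halts xss (afterSetEnd σ) (passing runs ℕ.≤-refl (ℕ.≤-reflexive start≡) start≡))
    where
    zss = mergePairs xss
    total≤′ : length (concat zss) ℕ.≤ n
    total≤′ = ≡.subst (ℕ._≤ n) (≡.sym (↭-length (mergePairs-↭ xss))) total≤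
    count≤′ : length zss ℕ.≤ n
    count≤′ = ≡.subst (ℕ._≤ n) (≡.sym (length-mergePairs xss)) (ℕ.≤-trans (ℕ.⌈n/2⌉≤n _) count≤)
    continue : PassHalts (afterSetEnd σ) zss → Halts sortBody σ _ (λ τ → Sorting τ zss)
    continue (halts {final = τ} run time≤ (passed runs′ _ _ start′ head′)) = halts (seq assignᴺ run)
      (ℕ.≤-trans (ℕ.+-monoʳ-≤ (entryCost setEnd) (ℕ.≤-trans time≤ (passTime≤ zss total≤′ count≤′)))
        (ℕ.≤-reflexive (x∙yz≈y∙xz (entryCost setEnd) (n ℕ.* mergeStep ℕ.+ n ℕ.* passStep) (costᵀ passGuard))))
      -- `passEnd` was set to the old `end`, so `head` stops exactly where the numbering of the new
      -- runs begins.
      (sorting (≡.subst (λ u → Runs (tapeOf τ) (startOf τ) u (τ ⟦ end ⟧) zss) (≡.sym head′) runs′)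
        start′ (mergePairs-↗ xss↗) total≤′ count≤′)

  sort-step : ∀ {σ xss} k → Sorting σ xss → σ ⟦ lit 2 ⊕ head ⟧ ℕ.≤ σ ⟦ end ⟧ →
    (∀ τ → Sorting τ (mergePairs xss) → Halts sortLoop τ (sortTime n k) (Sorted (mergePairs xss))) →
    Halts sortLoop σ (sortTime n (suc k)) (Sorted xss)
  sort-step {σ} {xss} k inv more rest = continue (round-halts σ xss inv)
    where
    continue : Halts sortBody σ _ (λ τ → Sorting τ (mergePairs xss)) →
      Halts sortLoop σ (sortTime n (suc k)) (Sorted xss)
    continue (halts run time≤ inv′) = weaken
      (≡.sym (ℕ.+-assoc (roundTime n) (k ℕ.* roundTime n) (costᵀ sortGuard)))
      (while-step (dec-true (_ ℕ.≤? _) more) run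
        (ℕ.≤-trans (ℕ.+-monoʳ-≤ (costᵀ sortGuard) time≤)
          (ℕ.≤-reflexive (x∙yz≈y∙xz (costᵀ sortGuard) (n ℕ.* mergeStep ℕ.+ n ℕ.* passStep) (entryCost sortBody))))
        (λ (sorted permuted ordered stored) → sorted (↭-trans permuted (mergePairs-↭ xss)) ordered stored)
        (rest _ inv′))

  -- Induction on the budget `k` of rounds. Halving the number of runs, rounded up, lowers its
  -- rounded-up logarithm by one; with two or more runs that logarithm is positive, so the budget
  -- cannot be 0.
  sort-halts : ∀ k xss σ → Sorting σ xss → ⌈log₂ length xss ⌉ ℕ.≤ k →
    Halts sortLoop σ (sortTime n k) (Sorted xss)
  sort-halts k [] σ (sorting head≡ start≡ _ _ _) _ = halts
    (while-false (dec-false (_ ℕ.≤? _) (λ head< → ℕ.<-irrefl head≡ (ℕ.<-trans ℕ.≤-refl head<))))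
    (ℕ.m≤n+m (costᵀ sortGuard) (k ℕ.* roundTime n))
    (sorted ↭-refl [] (≡.trans (≡.cong (startOf σ) head≡) start≡))
  sort-halts k (xs ∷ []) σ (sorting (seg , head≡) start≡ (xs↗ ∷ []) _ _) _ = halts
    (while-false (dec-false (_ ℕ.≤? _) (λ head< → ℕ.<-irrefl head≡ head<)))
    (ℕ.m≤n+m (costᵀ sortGuard) (k ℕ.* roundTime n))
    (sorted (↭-sym (++-identityʳ xs)) xs↗
      (≡.subst (λ u → Segment (tapeOf σ) (startOf σ (σ ⟦ head ⟧)) u xs)
        (≡.trans (≡.cong (startOf σ) head≡) start≡) seg))
  sort-halts zero (xs ∷ ys ∷ xss) σ inv log≤0 =
    contradiction
      (ℕ.≤-trans (⌈log₂⌉-mono-≤ {2} {suc (suc (length xss))} (ℕ.s≤s (ℕ.s≤s ℕ.z≤n))) log≤0) λ ()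
  sort-halts (suc k) xss@(xs ∷ ys ∷ yss) σ inv@(sorting (_ , _ , runs) _ _ _ _) log≤ =
    sort-step k inv (runs⇒≤ yss runs) (λ τ inv′ → sort-halts k (mergePairs xss) τ inv′ log≤′)
    where
    log≤′ : ⌈log₂ length (mergePairs xss) ⌉ ℕ.≤ k
    log≤′ = ≡.subst (ℕ._≤ k)
      (≡.sym (≡.trans (≡.cong ⌈log₂_⌉ (length-mergePairs xss)) (⌈log₂⌈n/2⌉⌉≡⌈log₂n⌉∸1 (length xss))))
      (ℕ.∸-monoˡ-≤ 1 log≤)

  -- Creating the singleton runs.

  record Initialised (σ : State) : Set where
    constructor initialised
    field
      tape≡  : ∀ {k} → k ℕ.< σ ⟦ free ⟧ → tapeOf σ k ≡ k
      -- Nonstrict, unlike for the tape: `n` singleton runs have `n + 1` boundaries.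
      start≡ : ∀ {k} → k ℕ.≤ σ ⟦ free ⟧ → startOf σ k ≡ k
      head≡  : σ ⟦ head ⟧ ≡ 0

  afterInit : State → State
  afterInit σ = record σ { ints = write 4 (suc (σ ⟦ free ⟧)) (suc (σ ⟦ free ⟧))
    (write 1 0 (suc (σ ⟦ free ⟧)) (write 0 (σ ⟦ free ⟧) (σ ⟦ free ⟧) (ints σ))) }

  write-<suc : ∀ b i {v μ k} → v ≡ i → (k ℕ.< i → μ b k ≡ k) → k ℕ.< suc i → write b i v μ b k ≡ k
  write-<suc b i {v} {μ} {k} ≡.refl below k<1+i with ℕ.m<1+n⇒m<n∨m≡n k<1+i
  ... | inj₁ k<i    = ≡.trans (write-other b i v μ (ℕ.<⇒≢ k<i)) (below k<i)
  ... | inj₂ ≡.refl = write-same b i v μ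

  afterInit-initialised : ∀ {σ} → Initialised σ → Initialised (afterInit σ)
  afterInit-initialised {σ} (initialised tape≡ start≡ head≡) = initialised
    (write-<suc 0 (σ ⟦ free ⟧) {μ = ints σ} ≡.refl tape≡)
    (λ k≤ → write-<suc 4 (suc (σ ⟦ free ⟧)) {μ = ints σ} ≡.refl (start≡ ∘ ℕ.s≤s⁻¹) (ℕ.s≤s k≤))
    head≡

  init-halts : ∀ d σ → d ℕ.+ σ ⟦ free ⟧ ≡ n → Initialised σ →
    Halts initLoop σ (d ℕ.* initStep ℕ.+ costᵀ initGuard) (λ τ → Initialised τ × τ ⟦ free ⟧ ≡ n)
  init-halts zero σ free≡n inv =
    while-stop (dec-false (_ ℕ.≤? _) (λ free<n → ℕ.<-irrefl free≡n free<n)) (inv , free≡n)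
  init-halts (suc d) σ d+free≡n inv =
    weaken (≡.sym (ℕ.+-assoc initStep (d ℕ.* initStep) (costᵀ initGuard)))
      (while-step (dec-true (_ ℕ.≤? _) free<n) (seq assignᴺ (seq assignᴺ assignᴺ)) ℕ.≤-refl (λ q → q)
        (init-halts d (afterInit σ) (≡.trans (ℕ.+-suc d (σ ⟦ free ⟧)) d+free≡n) (afterInit-initialised inv)))
    where
    free<n : suc (σ ⟦ free ⟧) ℕ.≤ n
    free<n = ≡.subst (suc (σ ⟦ free ⟧) ℕ.≤_) d+free≡n (ℕ.s≤s (ℕ.m≤n+m (σ ⟦ free ⟧) d))

  -- Generalised from `allFin n` to a tail of it, enumerated by `g` from `lo` on, so that induction
  -- on `k` applies.
  identity-runs : ∀ {f s} lo k (g : Fin k → Fin n) → lo ℕ.+ k ≡ n → (∀ i → toℕ (g i) ≡ lo ℕ.+ toℕ i) →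
    (∀ {k} → k ℕ.< n → f k ≡ k) → (∀ {k} → k ℕ.≤ n → s k ≡ k) → Runs f s lo n (map [_] (tabulate g))
  identity-runs lo zero g lo≡n g≡ f≡ s≡ = ≡.trans (≡.sym (ℕ.+-identityʳ lo)) lo≡n
  identity-runs {f} {s} lo (suc k) g lo≡n g≡ f≡ s≡ =
    (≡.trans (≡.cong f (s≡ (ℕ.<⇒≤ lo<n))) (≡.trans (f≡ lo<n)
       (≡.trans (≡.sym (ℕ.+-identityʳ lo)) (≡.sym (g≡ zero)))) ,
     ≡.trans (≡.cong suc (s≡ (ℕ.<⇒≤ lo<n))) (≡.sym (s≡ lo<n))) ,
    identity-runs (suc lo) k (g ∘ suc) (≡.trans (≡.sym (ℕ.+-suc lo k)) lo≡n)
      (λ i → ≡.trans (g≡ (suc i)) (ℕ.+-suc lo (toℕ i))) f≡ s≡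
    where
    lo<n : lo ℕ.< n
    lo<n = ≡.subst (lo ℕ.<_) lo≡n (ℕ.m<m+n lo (ℕ.s≤s ℕ.z≤n))

  singletons : List (List (Fin n))
  singletons = map [_] (allFin n)

  length-singletons : length singletons ≡ n
  length-singletons = ≡.trans (length-map [_] (allFin n)) (length-tabulate (λ i → i))

  initRuns-halts : Halts initRuns initial (initTime n) (λ τ → Sorting τ singletons)
  initRuns-halts = continue (init-halts n initial (ℕ.+-identityʳ n)
      -- Boundary 0 is never written by the loop; it relies on memory being zero at the start.
      (initialised (λ ()) (λ { ℕ.z≤n → ≡.refl }) ≡.refl))
    where
    continue : Halts initLoop initial (n ℕ.* initStep ℕ.+ costᵀ initGuard) (λ τ → Initialised τ × τ ⟦ free ⟧ ≡ n) →
      Halts initRuns initial (initTime n) (λ τ → Sorting τ singletons)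
    continue (halts {final = τ} run time≤ (initialised tape≡ start≡ head≡ , free≡n)) = halts (seq run assignᴺ)
      (ℕ.≤-trans (ℕ.+-monoˡ-≤ (entryCost storeCount) time≤)
        (ℕ.≤-reflexive (ℕ.+-assoc (n ℕ.* initStep) (costᵀ initGuard) (entryCost storeCount))))
      (sorting
        (≡.subst₂ (λ u v → Runs (tapeOf τ) (startOf τ) u v singletons) (≡.sym head≡) (≡.sym free≡n)
          (identity-runs 0 n (λ i → i) ≡.refl (λ _ → ≡.refl)
            (tape≡ ∘ ≡.subst (_ ℕ.<_) (≡.sym free≡n)) (start≡ ∘ ≡.subst (_ ℕ.≤_) (≡.sym free≡n))))
        (start≡ ℕ.≤-refl)
        (All.map⁺ (All.universal (λ _ → [-]) (allFin n)))
        (ℕ.≤-reflexive (≡.trans (≡.cong length (concat-map-[ allFin n ])) (length-tabulate (λ i → i))))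
        (ℕ.≤-reflexive length-singletons))

  -- Scanning for the largest consecutive ratio.

  record Scanned (σ : State) (xs : List (Fin n)) (τ : State) : Set (c ⊔ ℓ₂) where
    constructor scanned
    field
      increased : output σ ≤ output τ
      ratios≤   : Linked (λ i j → ratio i j ≤ output τ) xs
      -- `K` is assumed to bound all ordered pairs, not only neighbours: this is the form in which a
      -- Lipschitz `K` delivers its bounds.
      least     : ∀ K → output σ ≤ K → (∀ {i j} → i ≼ j → ratio i j ≤ K) → output τ ≤ K

  record Updated (σ : State) (x y : Fin n) (τ : State) : Set (c ⊔ ℓ₂) where
    constructor updated
    field
      ints≡     : ints τ ≡ write 2 0 (suc (σ ⟦ left ⟧)) (ints σ)
      increased : output σ ≤ output τ
      ratio≤    : ratio x y ≤ output τ
      least     : ∀ K → output σ ≤ K → ratio x y ≤ K → output τ ≤ K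

  ratioᴿ-value : ∀ {σ x y} → tapeOf σ (σ ⟦ left ⟧) ≡ toℕ x → tapeOf σ (suc (σ ⟦ left ⟧)) ≡ toℕ y →
    evalᴿ I ratioᴿ σ ≡ ratio x y
  ratioᴿ-value {x = x} {y} fx fy rewrite fx | fy
    | nth-toℕ 0# point x | nth-toℕ 0# point y
    | nth-toℕ 0# (λ i → nth 0# (RealRAM.Input.matrix I i) (toℕ y)) x
    | nth-toℕ 0# (RealRAM.Input.matrix I x) y = ≡.refl

  scanBody-halts : ∀ {σ x y} → tapeOf σ (σ ⟦ left ⟧) ≡ toℕ x → tapeOf σ (suc (σ ⟦ left ⟧)) ≡ toℕ y →
    Halts scanBody σ (entryCost scanBody) (Updated σ x y)
  scanBody-halts {σ} {x} {y} fx fy = compare (evalᴿ I ratioᴿ σ ≤? output σ)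
    where
    value : evalᴿ I ratioᴿ σ ≡ ratio x y
    value = ratioᴿ-value {σ} fx fy
    compare : Dec (evalᴿ I ratioᴿ σ ≤ output σ) → Halts scanBody σ (entryCost scanBody) (Updated σ x y)
    compare (yes r≤) = halts (seq (if-true (dec-true (_ ≤? _) r≤) skip) assignᴺ)
      -- Both costs are closed numerals, so the cheaper `skip` branch is compared by computation.
      (ℕ.≤ᵇ⇒≤ _ _ _)
      (updated ≡.refl ≤-refl (≡.subst (_≤ output σ) value r≤) (λ _ K≤ _ → K≤))
    compare (no r≰) = halts (seq (if-false (dec-false (_ ≤? _) r≰) assignᴿ) assignᴺ)
      ℕ.≤-refl
      (updated ≡.refl (≰⇒≥ r≰) (≡.subst (_≤ evalᴿ I ratioᴿ σ) value ≤-refl)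
        (λ K _ r≤K → ≡.subst (_≤ K) (≡.sym value) r≤K))

  scanTimeOf : ℕ → ℕ
  scanTimeOf l = l ℕ.* scanStep ℕ.+ costᵀ scanGuard

  scan-step : ∀ {σ x y ys} → suc (suc (σ ⟦ left ⟧)) ℕ.≤ σ ⟦ free ⟧ → x ≼ y →
    Segment (tapeOf σ) (suc (σ ⟦ left ⟧)) (σ ⟦ free ⟧) (y ∷ ys) →
    Halts scanBody σ (entryCost scanBody) (Updated σ x y) →
    (∀ τ → Segment (tapeOf τ) (τ ⟦ left ⟧) (τ ⟦ free ⟧) (y ∷ ys) →
      Halts scanLoop τ (scanTimeOf (length (y ∷ ys))) (Scanned τ (y ∷ ys))) →
    Halts scanLoop σ (scanTimeOf (length (x ∷ y ∷ ys))) (Scanned σ (x ∷ y ∷ ys))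
  scan-step {σ} {x} {y} {ys} more x≼y seg
    (halts {final = τ} run time≤ (updated ints≡ increased ratio≤ least)) rest =
    weaken (≡.sym (ℕ.+-assoc scanStep (length (y ∷ ys) ℕ.* scanStep) (costᵀ scanGuard)))
      (while-step (dec-true (_ ℕ.≤? _) more) run (ℕ.+-monoʳ-≤ (costᵀ scanGuard) time≤) extend
        (rest τ (≡.subst (λ μ → Segment (μ 0) (μ 2 0) (μ 1 0) (y ∷ ys)) (≡.sym ints≡) seg)))
    where
    extend : ∀ {υ} → Scanned τ (y ∷ ys) υ → Scanned σ (x ∷ y ∷ ys) υ
    extend (scanned increased′ ratios≤ least′) = scanned
      (≤-trans increased increased′) (≤-trans ratio≤ increased′ ∷ ratios≤)
      (λ K σ≤K ratio≤K → least′ K (least K σ≤K (ratio≤K x≼y)) ratio≤K)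

  scan-halts : ∀ xs σ → Segment (tapeOf σ) (σ ⟦ left ⟧) (σ ⟦ free ⟧) xs → Linked _≼_ xs →
    Halts scanLoop σ (scanTimeOf (length xs)) (Scanned σ xs)
  scan-halts [] σ left≡ [] =
    while-stop (dec-false (_ ℕ.≤? _) (λ left< → ℕ.<-irrefl left≡ (ℕ.<-trans ℕ.≤-refl left<)))
      (scanned ≤-refl [] (λ _ σ≤K _ → σ≤K))
  scan-halts (x ∷ []) σ (_ , left≡) [-] = halts
    (while-false (dec-false (_ ℕ.≤? _) (λ left< → ℕ.<-irrefl left≡ left<)))
    (ℕ.m≤n+m (costᵀ scanGuard) (1 ℕ.* scanStep))
    (scanned ≤-refl [-] (λ _ σ≤K _ → σ≤K))
  scan-halts (x ∷ y ∷ ys) σ (fx , seg@(fy , segʸ)) (x≼y ∷ ys↗) =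
    scan-step (segment⇒≤ ys segʸ) x≼y seg (scanBody-halts {σ} fx fy) (λ τ segτ → scan-halts (y ∷ ys) τ segτ ys↗)

  afterScanSetup : State → State
  afterScanSetup σ = record σ
    { ints  = write 2 0 (σ ⟦ start head ⟧) (ints σ)
    ; reals = write 0 0 0# (reals σ)
    }

  -- Starting the maximum at 0 makes the result nonnegative and costs no minimality, since competing
  -- constants are nonnegative too.
  scanned⇒lipschitzConstant : ∀ {σ τ xs} → output σ ≡ 0# → Linked _≼_ xs → (∀ i → i ∈ xs) →
    Scanned σ xs τ → IsLipschitzConstant ℝ P M f (output τ)
  scanned⇒lipschitzConstant {σ} {τ} output≡0 xs↗ complete (scanned increased ratios≤ least) =
    0≤output , consecutiveRatios≤⇒lipschitz 0≤output xs↗ ratios≤ complete ,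
    (λ K 0≤K lip → least K (≡.subst (_≤ K) (≡.sym output≡0) 0≤K)
      (λ {i} {j} → lipschitz⇒ratio≤ 0≤K lip {i} {j}))
    where
    0≤output : 0# ≤ output τ
    0≤output = ≡.subst (_≤ output τ) output≡0 increased

  scanPhase-halts : ∀ σ → Sorted singletons σ →
    Halts scan σ (scanTime n) (IsLipschitzConstant ℝ P M f ∘ output)
  scanPhase-halts σ (sorted {xs} permuted ordered stored) =
    continue (scan-halts xs (afterScanSetup σ) stored ordered)
    where
    xs↭all : xs ↭ allFin n
    xs↭all = ≡.subst (xs ↭_) (concat-map-[ allFin n ]) permuted
    length≡ : length xs ≡ n
    length≡ = ≡.trans (↭-length xs↭all) (length-tabulate (λ i → i))
    continue : Halts scanLoop (afterScanSetup σ) (scanTimeOf (length xs)) (Scanned (afterScanSetup σ) xs) →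
      Halts scan σ (scanTime n) (IsLipschitzConstant ℝ P M f ∘ output)
    continue (halts {final = τ} run time≤ post) = halts (seq assignᴺ (seq assignᴿ run))
      (ℕ.≤-trans (ℕ.+-monoʳ-≤ (entryCost rewind) (ℕ.+-monoʳ-≤ (entryCost clear) time≤)) (ℕ.≤-reflexive
        (≡.trans (rearrange (entryCost rewind) (entryCost clear) (length xs ℕ.* scanStep) (costᵀ scanGuard))
          (≡.cong (λ l → l ℕ.* scanStep ℕ.+ entryCost scan) length≡))))
      (scanned⇒lipschitzConstant {afterScanSetup σ} ≡.refl ordered
        (λ i → ∈-resp-↭ (↭-sym xs↭all) (∈-allFin i)) post)
      where
      rearrange : ∀ a b c d → a ℕ.+ (b ℕ.+ (c ℕ.+ d)) ≡ c ℕ.+ (a ℕ.+ (b ℕ.+ d))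
      rearrange = solve-∀

  halts-⨾ : ∀ {q q′ p p′ σ B C} {Q : State → Set q} {R : State → Set q′} →
    Halts p σ B Q → (∀ τ → Q τ → Halts p′ τ C R) → Halts (p ⨾ p′) σ (B ℕ.+ C) R
  halts-⨾ (halts run s≤B q) next with halts run′ t≤C r ← next _ q =
    halts (seq run run′) (ℕ.+-mono-≤ s≤B t≤C) r

  program-halts : Halts lipschitzProgram initial (runningTime n) (IsLipschitzConstant ℝ P M f ∘ output)
  program-halts = weaken (phases≡runningTime n)
    (halts-⨾ initRuns-halts λ σ inv →
     halts-⨾ (sort-halts ⌈log₂ n ⌉ singletons σ inv (ℕ.≤-reflexive (≡.cong ⌈log₂_⌉ length-singletons)))
       scanPhase-halts)

open import Data.Nat.Base using (_*_; _≤_)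

proposition8p2 : ∀ {c ℓ₁ ℓ₂ m ℓ} (ℝ : RealNumbers c ℓ₁ ℓ₂) (let open RealRAM ℝ) →
    ∃[ prog ] ∃[ T ]
    (T ∈O (λ n → n * ⌊log₂ n ⌋)) ×
    (∀ (n : ℕ) (P : PointSet ℝ n) (M : MetricSpace ℝ m ℓ) (f : Fin n → MetricSpace.Carrier M) →
    ∃[ t ] ∃[ σ ]
    (inputOf ℝ P M f ⊢⟨ prog , initial ⟩⇓[ t ] σ) ×
    t ≤ T n ×
    IsLipschitzConstant ℝ P M f (output σ))
proposition8p2 ℝ = lipschitzProgram , runningTime , runningTime∈O , λ n P M f →
  let open Execution.Halts (Execution.program-halts ℝ P M f)
  in time , final , run , time≤ , post
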